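{- For every $\varepsilon>0$ there exists a sequence of unsatisfiable hitting formulas $G_m$, each containing $2^{\tilde O(m)}$ clauses, each clause of width at most $\tilde O(m)$, such that every tree-like resolution refutation of $G_m$ has size $2^{\tilde\Omega(m^{2-\varepsilon})}$.
   Context: A hitting formula is a CNF in which every two distinct clauses contain complementary literals (some literal $\ell$ in one and $\bar\ell$ in the other). The width of a clause is its number of literals. Tree-like resolution refutations are resolution refutations in which every derived clause is used at most once as a premise; size is the number of clauses. $\tilde O(f)$ denotes $O(f\log^C f)$ and $\tilde\Omega(f)$ denotes $\Omega(f/\log^C f)$ for some constant $C$. -}

module Defs where

open import Data.Nat using (ℕ; zero; suc; _+_)
open import Data.Bool using (Bool; true; false)
open import Data.List using (List; length)
open import Data.List.Membership.Propositional using (_∈_)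
open import Data.List.Relation.Unary.Any using (Any)
open import Data.List.Relation.Unary.All using (All)
open import Data.Fin using (Fin)
open import Data.Product using (Σ; _×_; ∃-syntax)
open import Data.Sum using (_⊎_)
open import Relation.Binary.PropositionalEquality using (_≡_)
open import Relation.Nullary using (¬_)
open import Function.Bundles using (_⇔_)
open import Data.List.Base using (lookup)

record Literal : Set where
  constructor lit
  field
    var : ℕ
    pol : Bool
open Literal public

neg : Bool → Bool
neg true = false
neg false = true

comp : Literal → Literal
comp (lit x b) = lit x (neg b)

Clause : Set
Clause = List Literal

CNF : Set
CNF = List Clause

width : Clause → ℕ
width = length

numClauses : CNF → ℕ
numClauses = length

Assignment : Set
Assignment = ℕ → Bool

SatLit : Assignment → Literal → Set
SatLit α (lit x b) = α x ≡ b

SatClause : Assignment → Clause → Set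
SatClause α C = Any (SatLit α) C

SatCNF : Assignment → CNF → Set
SatCNF α F = All (SatClause α) F

Unsatisfiable : CNF → Set
Unsatisfiable F = (α : Assignment) → ¬ SatCNF α F

Hitting : CNF → Set
Hitting F = (i j : Fin (length F)) → ¬ (i ≡ j) →
  ∃[ l ] (l ∈ lookup F i × comp l ∈ lookup F j)

IsResolvent : Clause → Clause → Literal → Clause → Set
IsResolvent A B l C =
  l ∈ A × comp l ∈ B ×
  ((k : Literal) → (k ∈ C) ⇔ ((k ∈ A × ¬ (k ≡ l)) ⊎ (k ∈ B × ¬ (k ≡ comp l))))

data TreeDeriv (F : CNF) : Clause → Set where
  axiom : ∀ {C} → C ∈ F → TreeDeriv F C
  res   : ∀ {A B C} (l : Literal) → TreeDeriv F A → TreeDeriv F B →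
          IsResolvent A B l C → TreeDeriv F C

size : ∀ {F C} → TreeDeriv F C → ℕ
size (axiom _) = 1
size (res _ d e _) = suc (size d + size e)

TreeRefutation : CNF → Set
TreeRefutation F = TreeDeriv F Data.List.[]

module Submission where

-- The construction follows Ambainis, Kokainis and Kothari. Start from the conjunction
-- of n variables and repeat: take the disjunction of n copies of the current function,
-- turn it into a cheat sheet function, and take the conjunction of n copies of that.
-- In the cheat sheet, c = O(log) copies of the function address one of 2 ^ c cells, and
-- the output is 1 iff that cell points to valid certificates for these c values. Ones
-- then have unambiguous certificates no larger than the ordinary ones, while an
-- adversary can keep all addresses possible and some cell unread. After k rounds, up
-- to polylogarithmic factors, ordinary certificates of zeros have size n ^ k, those of
-- ones and all unambiguous certificates have size n ^ (k + 1), and the query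
-- complexity is n ^ (2 k + 1). The unambiguous certificates are the clauses of a
-- hitting formula. Replacing each variable by an exclusive or of two turns the query
-- lower bound into a lower bound on the logarithm of the tree size. With m = n ^ (k + 1)
-- the exponent is 2 − 1 / (k + 1), and k = q rounds suffice for ε = p / q ≥ 1 / q.

open import Defs
open import Data.Nat using (ℕ; _+_; _*_; _∸_; _^_; _≤_; _<_)
open import Data.Nat.Logarithm using (⌊log₂_⌋; ⌈log₂_⌉)
open import Data.List.Relation.Unary.All using (All)
open import Data.Product using (Σ; _×_; ∃-syntax)
open import Data.Nat using (zero; suc; z≤n; s≤s; >-nonZero; _≟_)
open import Data.Nat.Binary using (ℕᵇ; 2[1+_]; 1+[2_]; toℕ; fromℕ)
open import Data.Nat.Binary.Properties using (fromℕ-toℕ)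
open import Data.Nat.Logarithm using (⌊log₂⌋-mono-≤; ⌈log₂⌉-mono-≤; ⌊log₂[2^n]⌋≡n; ⌈log₂2^n⌉≡n)
open import Data.Nat.Properties hiding (_≟_)
open import Data.Nat.Tactic.RingSolver using (solve-∀)
open import Data.Bool using (Bool; true; false)
open import Data.Bool.Properties using () renaming (_≟_ to _≟ᵇ_)
open import Data.Empty using (⊥; ⊥-elim)
open import Data.Fin using (zero; suc)
open import Data.List using (List; []; _∷_; _++_; map; length; replicate)
open import Data.List.Properties using (length-map; length-++; length-replicate; ≡-dec)
open import Data.List.Membership.Propositional using (_∈_)
open import Data.List.Membership.Propositional.Properties
  using (∈-map⁺; ∈-map⁻; ∈-++⁺ˡ; ∈-++⁺ʳ; ∈-++⁻; ∈-lookup)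
open import Data.List.Relation.Unary.All using ([]; _∷_)
import Data.List.Relation.Unary.All as All
import Data.List.Relation.Unary.All.Properties as All
open import Data.List.Relation.Unary.AllPairs using (AllPairs; []; _∷_)
import Data.List.Relation.Unary.AllPairs as AllPairs
import Data.List.Relation.Unary.AllPairs.Properties as AllPairs
open import Data.List.Relation.Unary.Any using (here; there; any?)
open import Data.Maybe using (Maybe; just; nothing)
open import Data.Product using (_,_; proj₁; proj₂)
open import Data.Sum using (inj₁; inj₂)
open import Data.Unit using (⊤; tt)
open import Data.Vec using (Vec; []; _∷_; toList)
import Data.Vec.Properties as Vec
open import Function using (_∘_)
open import Function.Bundles using (Equivalence)
open import Relation.Binary.PropositionalEquality using (_≡_; refl; sym; trans; cong; cong₂; subst)
open import Relation.Nullary using (¬_; Dec; yes; no)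

-- Terms and conflicts

neg-involutive : ∀ b → neg (neg b) ≡ b
neg-involutive true  = refl
neg-involutive false = refl

b≢neg-b : ∀ {b} → ¬ (b ≡ neg b)
b≢neg-b {true}  ()
b≢neg-b {false} ()

≢⇒≡neg : ∀ {a b} → ¬ (a ≡ b) → b ≡ neg a
≢⇒≡neg {true}  {true}  a≢b = ⊥-elim (a≢b refl)
≢⇒≡neg {true}  {false} a≢b = refl
≢⇒≡neg {false} {true}  a≢b = refl
≢⇒≡neg {false} {false} a≢b = ⊥-elim (a≢b refl)

Var : Set
Var = List Bool

Valuation : Set
Valuation = Var → Bool

Term : Set
Term = List (Var × Bool)

_⊨_ : Valuation → Term → Set
α ⊨ t = All (λ l → α (proj₁ l) ≡ proj₂ l) t

Conf : Term → Term → Set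
Conf s t = Σ Var λ v → Σ Bool λ b → (v , b) ∈ s × (v , neg b) ∈ t

_⊆ᵗ_ : Term → Term → Set
s ⊆ᵗ t = ∀ {l} → l ∈ s → l ∈ t

Conf-sym : ∀ {s t} → Conf s t → Conf t s
Conf-sym (v , b , p , q) = v , neg b , q , subst (λ x → (v , x) ∈ _) (sym (neg-involutive b)) p

Conf-⊆ : ∀ {s s' t t'} → s ⊆ᵗ s' → t ⊆ᵗ t' → Conf s t → Conf s' t'
Conf-⊆ f g (v , b , p , q) = v , b , f p , g q

Conf-unsat : ∀ {α s t} → Conf s t → α ⊨ s → α ⊨ t → ⊥
Conf-unsat (v , b , p , q) σ τ = b≢neg-b (trans (sym (All.lookup σ p)) (All.lookup τ q))

lift : Bool → Term → Term
lift b = map λ l → b ∷ proj₁ l , proj₂ l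

Conf-lift : ∀ b {s t} → Conf s t → Conf (lift b s) (lift b t)
Conf-lift b (v , c , p , q) = b ∷ v , c , ∈-map⁺ _ p , ∈-map⁺ _ q

-- Families of terms

-- Families of terms are kept in binary trees, so that a family of 2^d terms can
-- be indexed by d bits; its depth plays the role of the logarithm of its size.
data Tree (A : Set) : Set where
  ∅   : Tree A
  one : A → Tree A
  _⋎_ : Tree A → Tree A → Tree A

data _∈ᵗ_ {A : Set} (x : A) : Tree A → Set where
  here  : x ∈ᵗ one x
  left  : ∀ {s t} → x ∈ᵗ s → x ∈ᵗ (s ⋎ t)
  right : ∀ {s t} → x ∈ᵗ t → x ∈ᵗ (s ⋎ t)

bind : ∀ {A B} → Tree A → (A → Tree B) → Tree B
bind ∅       k = ∅
bind (one x) k = k x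
bind (s ⋎ t) k = bind s k ⋎ bind t k

mapᵗ : ∀ {A B} → (A → B) → Tree A → Tree B
mapᵗ f t = bind t (one ∘ f)

_⊛_ : Tree Term → Tree Term → Tree Term
s ⊛ t = bind s λ x → mapᵗ (x ++_) t

liftᵗ : Bool → Tree Term → Tree Term
liftᵗ b = mapᵗ (lift b)

∈-bind⁺ : ∀ {A B x y} {k : A → Tree B} {t} → x ∈ᵗ t → y ∈ᵗ k x → y ∈ᵗ bind t k
∈-bind⁺ here      q = q
∈-bind⁺ (left p)  q = left (∈-bind⁺ p q)
∈-bind⁺ (right p) q = right (∈-bind⁺ p q)

∈-bind⁻ : ∀ {A B y} {k : A → Tree B} t → y ∈ᵗ bind t k → Σ A λ x → x ∈ᵗ t × y ∈ᵗ k x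
∈-bind⁻ (one x) p = x , here , p
∈-bind⁻ (s ⋎ t) (left p) with x , q , r ← ∈-bind⁻ s p = x , left q , r
∈-bind⁻ (s ⋎ t) (right p) with x , q , r ← ∈-bind⁻ t p = x , right q , r

∈-mapᵗ⁻ : ∀ {A B y} {f : A → B} t → y ∈ᵗ mapᵗ f t → Σ A λ x → x ∈ᵗ t × y ≡ f x
∈-mapᵗ⁻ t p with x , q , here ← ∈-bind⁻ t p = x , q , refl

-- A view of membership in `s ⊛ t`: matching on it exposes the term as `x ++ y`.
data _∈⊛_,_ : Term → Tree Term → Tree Term → Set where
  mk : ∀ {x y s t} → x ∈ᵗ s → y ∈ᵗ t → (x ++ y) ∈⊛ s , t

∈-⊛⁻ : ∀ {x} s t → x ∈ᵗ (s ⊛ t) → x ∈⊛ s , t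
∈-⊛⁻ s t p with x , q , r ← ∈-bind⁻ s p with y , q' , refl ← ∈-mapᵗ⁻ t r = mk q q'

_⊨∃_ : Valuation → Tree Term → Set
α ⊨∃ t = Σ Term λ x → x ∈ᵗ t × α ⊨ x

⊨∃-⊛ : ∀ {α s t} → α ⊨∃ s → α ⊨∃ t → α ⊨∃ (s ⊛ t)
⊨∃-⊛ (x , p , σ) (y , q , τ) = x ++ y , ∈-bind⁺ p (∈-bind⁺ q here) , All.++⁺ σ τ

⊨∃-lift : ∀ {α} b {t} → (λ v → α (b ∷ v)) ⊨∃ t → α ⊨∃ liftᵗ b t
⊨∃-lift b (x , p , σ) = lift b x , ∈-bind⁺ p here , All.map⁺ σ

-- Hitting families and bounds on their size

-- Demanding conflicts across every node makes all leaves at different positions conflict, without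
-- comparing positions.
Hit : Tree Term → Set
Hit ∅       = ⊤
Hit (one x) = ⊤
Hit (s ⋎ t) = Hit s × Hit t × (∀ {x y} → x ∈ᵗ s → y ∈ᵗ t → Conf x y)

-- Terms grown from the same leaf conflict by `hk`; terms grown from different leaves inherit the
-- conflict of these leaves through `c`.
Hit-bind : ∀ {k : Term → Tree Term} t → Hit t → (∀ x → Hit (k x)) →
  (∀ {x x' y y'} → Conf x x' → y ∈ᵗ k x → y' ∈ᵗ k x' → Conf y y') → Hit (bind t k)
Hit-bind ∅       h hk c = tt
Hit-bind (one x) h hk c = hk x
Hit-bind (s ⋎ t) (hs , ht , st) hk c = Hit-bind s hs hk c , Hit-bind t ht hk c , λ p q →
  let x , p₁ , p₂ = ∈-bind⁻ s p
      y , q₁ , q₂ = ∈-bind⁻ t q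
  in c (st p₁ q₁) p₂ q₂

Hit-mapᵗ : ∀ {f} → (∀ {x y} → Conf x y → Conf (f x) (f y)) → ∀ t → Hit t → Hit (mapᵗ f t)
Hit-mapᵗ c t h = Hit-bind t h (λ _ → tt) λ { d here here → c d }

Hit-lift : ∀ b t → Hit t → Hit (liftᵗ b t)
Hit-lift b = Hit-mapᵗ (Conf-lift b)

Hit-⊛ : ∀ s t → Hit s → Hit t → Hit (s ⊛ t)
Hit-⊛ s t hs ht = Hit-bind s hs
  (λ x → Hit-mapᵗ (λ {y} {z} → Conf-⊆ (∈-++⁺ʳ x) (∈-++⁺ʳ x)) t ht)
  conf
  where
  conf : ∀ {x x' y y'} → Conf x x' → y ∈ᵗ mapᵗ (x ++_) t → y' ∈ᵗ mapᵗ (x' ++_) t → Conf y y'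
  conf c p q with _ , _ , refl ← ∈-mapᵗ⁻ t p | _ , _ , refl ← ∈-mapᵗ⁻ t q = Conf-⊆ ∈-++⁺ˡ ∈-++⁺ˡ c

data Bounded : ℕ → ℕ → Tree Term → Set where
  ∅   : ∀ {d w} → Bounded d w ∅
  one : ∀ {d w x} → length x ≤ w → Bounded d w (one x)
  _⋎_ : ∀ {d w s t} → Bounded d w s → Bounded d w t → Bounded (suc d) w (s ⋎ t)

Bounded-≤ : ∀ {d w d' w' t} → d ≤ d' → w ≤ w' → Bounded d w t → Bounded d' w' t
Bounded-≤ p       q ∅       = ∅
Bounded-≤ p       q (one x) = one (≤-trans x q)
Bounded-≤ (s≤s p) q (a ⋎ b) = Bounded-≤ p q a ⋎ Bounded-≤ p q b

Bounded-bind : ∀ {d w d' w' t} {k : Term → Tree Term} → Bounded d w t →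
  (∀ x → length x ≤ w → Bounded d' w' (k x)) → Bounded (d + d') w' (bind t k)
Bounded-bind ∅ f = ∅
Bounded-bind {d} (one x) f = Bounded-≤ (m≤n+m _ d) ≤-refl (f _ x)
Bounded-bind (a ⋎ b) f = Bounded-bind a f ⋎ Bounded-bind b f

Bounded-mapᵗ : ∀ {d w w' t f} → (∀ x → length x ≤ w → length (f x) ≤ w') →
  Bounded d w t → Bounded d w' (mapᵗ f t)
Bounded-mapᵗ g ∅       = ∅
Bounded-mapᵗ g (one x) = one (g _ x)
Bounded-mapᵗ g (a ⋎ b) = Bounded-mapᵗ g a ⋎ Bounded-mapᵗ g b

Bounded-lift : ∀ {d w t} b → Bounded d w t → Bounded d w (liftᵗ b t)
Bounded-lift b = Bounded-mapᵗ λ x p → ≤-trans (≤-reflexive (length-map _ x)) p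

Bounded-⊛ : ∀ {d w d' w' s t} → Bounded d w s → Bounded d' w' t → Bounded (d + d') (w + w') (s ⊛ t)
Bounded-⊛ a b = Bounded-bind a λ x p → Bounded-mapᵗ
  (λ y q → ≤-trans (≤-reflexive (length-++ x)) (+-mono-≤ p q)) b

-- Certificates, partitions and query adversaries

data Kind : Set where
  cert part : Kind

-- For every output o, the family `fam cert o` consists of possibly overlapping
-- certificates of o, while the families `fam part o` together form a partition
-- of the cube. No value map is kept: the value of α is any o it has certificates for.
record Prob (O : Set) : Set where
  field
    fam   : Kind → O → Tree Term
    cover : ∀ α → Σ O λ o → ∀ k → α ⊨∃ fam k o
    opp   : ∀ {o o'} → ¬ (o ≡ o') → ∀ k k' {s t} → s ∈ᵗ fam k o → t ∈ᵗ fam k' o' → Conf s t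
    hit   : ∀ o → Hit (fam part o)
open Prob

-- By `cover` some `o` qualifies, and by `opp` no two different ones do.
Value : ∀ {O} → Prob O → Valuation → O → Set
Value P α o = ∀ k → α ⊨∃ fam P k o

_∩[_≔_] : (Valuation → Set) → Var → Bool → Valuation → Set
(S ∩[ v ≔ b ]) α = S α × α v ≡ b

-- An adversary can answer d ∸ 1 queries, keeping every output possible all along.
Hard : ∀ {O} → Prob O → ℕ → (Valuation → Set) → Set
Hard P zero    S = ⊤
Hard P (suc d) S = (∀ o → Σ Valuation λ α → S α × Value P α o)
                 × (∀ v → Σ Bool λ b → Hard P d (S ∩[ v ≔ b ]))

Hard-⊆ : ∀ {O} (P : Prob O) d {S S'} → (∀ {α} → S α → S' α) → Hard P d S → Hard P d S'
Hard-⊆ P zero    i h = tt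
Hard-⊆ P (suc d) i (o , q) =
  (λ x → let α , s , a = o x in α , i s , a) ,
  (λ v → let b , h = q v in b , Hard-⊆ P d (λ (s , e) → i s , e) h)

Hard-pred : ∀ {O} (P : Prob O) d {S} → Hard P (suc d) S → Hard P d S
Hard-pred P zero    h = tt
Hard-pred P (suc d) (o , q) = o , λ v → let b , h = q v in b , Hard-pred P d h

Hard-≤ : ∀ {O} (P : Prob O) {d e S} → d ≤ e → Hard P e S → Hard P d S
Hard-≤ P z≤n h = tt
Hard-≤ P (s≤s p) (o , q) = o , λ v → let b , h = q v in b , Hard-≤ P p h

join : Valuation → Valuation → Valuation
join α β []          = false
join α β (false ∷ v) = α v
join α β (true  ∷ v) = β v

-- The variable `[]` lies in neither half. It is pinned to false, so an adversary can answer a query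
-- to it without changing the set.
_⊠_ : (Valuation → Set) → (Valuation → Set) → Valuation → Set
(S ⊠ T) α = α [] ≡ false × S (λ v → α (false ∷ v)) × T (λ v → α (true ∷ v))

-- A single variable and negation

single : Prob Bool
single .fam k o = one (([] , o) ∷ [])
single .cover α = α [] , λ k → _ , here , refl ∷ []
single .opp o≢o' k k' here here = [] , _ , here refl , here (cong ([] ,_) (sym (≢⇒≡neg o≢o')))
single .hit o = tt

single-Hard : Hard single 1 (λ _ → ⊤)
single-Hard = (λ o → (λ _ → o) , tt , λ k → _ , here , refl ∷ []) , λ v → false , tt

flip : Prob Bool → Prob Bool
flip P .fam k o = fam P k (neg o)
flip P .cover α = let o , σ = cover P α in
  neg o , λ k → subst (λ x → α ⊨∃ fam P k x) (sym (neg-involutive o)) (σ k)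
flip P .opp {o} {o'} n = opp P λ e →
  n (trans (sym (neg-involutive o)) (trans (cong neg e) (neg-involutive o')))
flip P .hit o = hit P (neg o)

flip-Hard : ∀ P d {S} → Hard P d S → Hard (flip P) d S
flip-Hard P zero    h = tt
flip-Hard P (suc d) (o , q) = (λ x → o (neg x)) , λ v → let b , h = q v in b , flip-Hard P d h

-- Conjunction of two copies

-- A partition of the zeros of a conjunction of two copies reads the second copy
-- only after the first one is known to be true.
module _ (P : Prob Bool) where

  andFam : Kind → Bool → Tree Term
  andFam k    true  = liftᵗ false (fam P k true) ⊛ liftᵗ true (fam P k true)
  andFam cert false = liftᵗ false (fam P cert false) ⋎ liftᵗ true (fam P cert false)
  andFam part false = liftᵗ false (fam P part false)
                    ⋎ (liftᵗ false (fam P part true) ⊛ liftᵗ true (fam P part false))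

  and-true : ∀ {α} → Value P (λ v → α (false ∷ v)) true → Value P (λ v → α (true ∷ v)) true →
    ∀ k → α ⊨∃ andFam k true
  and-true σ τ k = ⊨∃-⊛ (⊨∃-lift false (σ k)) (⊨∃-lift true (τ k))

  and-falseˡ : ∀ {α} → Value P (λ v → α (false ∷ v)) false → ∀ k → α ⊨∃ andFam k false
  and-falseˡ σ cert = let x , p , τ = ⊨∃-lift false (σ cert) in x , left p , τ
  and-falseˡ σ part = let x , p , τ = ⊨∃-lift false (σ part) in x , left p , τ

  and-falseʳ : ∀ {α} → Value P (λ v → α (false ∷ v)) true → Value P (λ v → α (true ∷ v)) false →
    ∀ k → α ⊨∃ andFam k false
  and-falseʳ σ τ cert = let x , p , ω = ⊨∃-lift true (τ cert) in x , right p , ω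
  and-falseʳ σ τ part =
    let x , p , ω = ⊨∃-⊛ (⊨∃-lift false (σ part)) (⊨∃-lift true (τ part)) in x , right p , ω

  lift-opp : ∀ b {o o'} → ¬ (o ≡ o') → ∀ k k' {s t} →
    s ∈ᵗ liftᵗ b (fam P k o) → t ∈ᵗ liftᵗ b (fam P k' o') → Conf s t
  lift-opp b n k k' p q with _ , p' , refl ← ∈-mapᵗ⁻ (fam P k _) p | _ , q' , refl ← ∈-mapᵗ⁻ (fam P k' _) q =
    Conf-lift b (opp P n k k' p' q')

  -- A term for true certifies both copies, so it conflicts with a term for false inside the copy
  -- that the latter certifies to be false.
  and-opp : ∀ k k' {s t} → s ∈ᵗ andFam k true → t ∈ᵗ andFam k' false → Conf s t
  and-opp k k' p q with ∈-⊛⁻ (liftᵗ false (fam P k true)) (liftᵗ true (fam P k true)) p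
  and-opp k cert p (left q)  | mk a b = Conf-⊆ ∈-++⁺ˡ (λ z → z) (lift-opp false (λ ()) k cert a q)
  and-opp k cert p (right q) | mk {x} a b = Conf-⊆ (∈-++⁺ʳ x) (λ z → z) (lift-opp true (λ ()) k cert b q)
  and-opp k part p (left q)  | mk a b = Conf-⊆ ∈-++⁺ˡ (λ z → z) (lift-opp false (λ ()) k part a q)
  and-opp k part p (right q) | mk {x} a b with ∈-⊛⁻ (liftᵗ false (fam P part true)) (liftᵗ true (fam P part false)) q
  ... | mk {x'} c d = Conf-⊆ (∈-++⁺ʳ x) (∈-++⁺ʳ x') (lift-opp true (λ ()) k part b d)

  and² : Prob Bool
  and² .fam = andFam
  and² .cover α with cover P (λ v → α (false ∷ v))
  ... | false , σ = false , and-falseˡ σ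
  ... | true  , σ with cover P (λ v → α (true ∷ v))
  ...   | false , τ = false , and-falseʳ σ τ
  ...   | true  , τ = true , and-true σ τ
  and² .opp {true}  {true}  n k k' p q = ⊥-elim (n refl)
  and² .opp {true}  {false} n k k' p q = and-opp k k' p q
  and² .opp {false} {true}  n k k' p q = Conf-sym (and-opp k' k q p)
  and² .opp {false} {false} n k k' p q = ⊥-elim (n refl)
  and² .hit true = Hit-⊛ _ _ (Hit-lift false _ (hit P true)) (Hit-lift true _ (hit P true))
  and² .hit false = Hit-lift false _ (hit P false) ,
    Hit-⊛ _ _ (Hit-lift false _ (hit P true)) (Hit-lift true _ (hit P false)) , cross
    where
    cross : ∀ {x y} → x ∈ᵗ liftᵗ false (fam P part false) →
      y ∈ᵗ (liftᵗ false (fam P part true) ⊛ liftᵗ true (fam P part false)) → Conf x y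
    cross p q with ∈-⊛⁻ (liftᵗ false (fam P part true)) (liftᵗ true (fam P part false)) q
    ... | mk a b = Conf-⊆ (λ z → z) ∈-++⁺ˡ (lift-opp false (λ ()) part part p a)

  -- With the first copy answered from a fixed `α` of value true, the conjunction equals the second
  -- copy, whose adversary takes over.
  and²-deadˡ : ∀ d {S T α} → S α → Value P α true → Hard P d T → Hard and² d (S ⊠ T)
  and²-deadˡ zero    s σ h = tt
  and²-deadˡ (suc d) {S} {T} {α} s σ h@(o , q) = vals , ask
    where
    vals : ∀ o' → Σ Valuation λ γ → (S ⊠ T) γ × Value and² γ o'
    vals true  = let β , t , τ = o true in join α β , (refl , s , t) , and-true σ τ
    vals false = let β , t , τ = o false in join α β , (refl , s , t) , and-falseʳ σ τ
    ask : ∀ v → Σ Bool λ b → Hard and² d ((S ⊠ T) ∩[ v ≔ b ])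
    ask [] = false , Hard-⊆ and² d (λ u → u , proj₁ u) (and²-deadˡ d {S} {T} s σ (Hard-pred P d h))
    ask (false ∷ v) = α v , Hard-⊆ and² d (λ (e , (u , e') , w) → (e , u , w) , e')
      (and²-deadˡ d {S ∩[ v ≔ α v ]} {T} (s , refl) σ (Hard-pred P d h))
    ask (true ∷ v) with b , h' ← q v = b , Hard-⊆ and² d (λ (e , u , w , e') → (e , u , w) , e')
      (and²-deadˡ d {S} {T ∩[ v ≔ b ]} s σ h')

  and²-deadʳ : ∀ d {S T β} → T β → Value P β true → Hard P d S → Hard and² d (S ⊠ T)
  and²-deadʳ zero    t τ h = tt
  and²-deadʳ (suc d) {S} {T} {β} t τ h@(o , q) = vals , ask
    where
    vals : ∀ o' → Σ Valuation λ γ → (S ⊠ T) γ × Value and² γ o'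
    vals true  = let α , s , σ = o true in join α β , (refl , s , t) , and-true σ τ
    vals false = let α , s , σ = o false in join α β , (refl , s , t) , and-falseˡ σ
    ask : ∀ v → Σ Bool λ b → Hard and² d ((S ⊠ T) ∩[ v ≔ b ])
    ask [] = false , Hard-⊆ and² d (λ u → u , proj₁ u) (and²-deadʳ d {S} {T} t τ (Hard-pred P d h))
    ask (true ∷ v) = β v , Hard-⊆ and² d (λ (e , u , w , e') → (e , u , w) , e')
      (and²-deadʳ d {S} {T ∩[ v ≔ β v ]} (t , refl) τ (Hard-pred P d h))
    ask (false ∷ v) with b , h' ← q v = b , Hard-⊆ and² d (λ (e , (u , e') , w) → (e , u , w) , e')
      (and²-deadʳ d {S ∩[ v ≔ b ]} {T} t τ h')

  -- A copy whose budget is used up is set to true, which leaves the outcome to the other copy.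
  and²-alive : ∀ e d d' {S T} → e ≤ suc d + suc d' →
    Hard P (suc d) S → Hard P (suc d') T → Hard and² e (S ⊠ T)
  and²-alive zero    d d' e≤ h h' = tt
  and²-alive (suc e) d d' {S} {T} (s≤s e≤) h@(o , q) h'@(o' , q') = vals , ask
    where
    vals : ∀ x → Σ Valuation λ γ → (S ⊠ T) γ × Value and² γ x
    vals true  = let α , s , σ = o true ; β , t , τ = o' true in
      join α β , (refl , s , t) , and-true σ τ
    vals false = let α , s , σ = o true ; β , t , τ = o' false in
      join α β , (refl , s , t) , and-falseʳ σ τ
    e≤' : e ≤ d' + suc d
    e≤' = ≤-trans e≤ (≤-reflexive (trans (+-suc d d') (trans (cong suc (+-comm d d')) (sym (+-suc d' d)))))
    askˡ : ∀ d v → e ≤ d + suc d' → Σ Bool (λ b → Hard P d (S ∩[ v ≔ b ])) →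
      Σ Bool λ b → Hard and² e ((S ⊠ T) ∩[ false ∷ v ≔ b ])
    askˡ zero v e≤ _ with α , s , σ ← o true = α v ,
      Hard-⊆ and² e (λ (e , (u , e') , w) → (e , u , w) , e')
        (and²-deadˡ e {S ∩[ v ≔ α v ]} {T} (s , refl) σ (Hard-≤ P e≤ h'))
    askˡ (suc d) v e≤ (b , k) = b ,
      Hard-⊆ and² e (λ (e , (u , e') , w) → (e , u , w) , e')
        (and²-alive e d d' {S ∩[ v ≔ b ]} {T} e≤ k h')
    askʳ : ∀ d' v → e ≤ d' + suc d → Σ Bool (λ b → Hard P d' (T ∩[ v ≔ b ])) →
      Σ Bool λ b → Hard and² e ((S ⊠ T) ∩[ true ∷ v ≔ b ])
    askʳ zero v e≤ _ with β , t , τ ← o' true = β v ,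
      Hard-⊆ and² e (λ (e , u , w , e') → (e , u , w) , e')
        (and²-deadʳ e {S} {T ∩[ v ≔ β v ]} (t , refl) τ (Hard-≤ P e≤ h))
    askʳ (suc d') v e≤ (b , k) = b ,
      Hard-⊆ and² e (λ (e , u , w , e') → (e , u , w) , e')
        (and²-alive e d d' {S} {T ∩[ v ≔ b ]} (≤-trans e≤ (≤-reflexive (+-comm (suc d') (suc d)))) h k)
    ask : ∀ v → Σ Bool λ b → Hard and² e ((S ⊠ T) ∩[ v ≔ b ])
    ask [] = false , Hard-⊆ and² e (λ u → u , proj₁ u) (and²-alive e d d' {S} {T} (≤-trans e≤ (n≤1+n _)) h h')
    ask (false ∷ v) = askˡ d v e≤ (q v)
    ask (true ∷ v)  = askʳ d' v e≤' (q' v)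

All-valuations : Valuation → Set
All-valuations _ = ⊤

and²-Hard : ∀ P d → 0 < d → Hard P d All-valuations → Hard (and² P) (d + d) All-valuations
and²-Hard P (suc d) _ h = Hard-⊆ (and² P) (suc d + suc d) (λ _ → tt)
  (and²-alive P (suc d + suc d) d d ≤-refl h h)

-- Tuples of independent copies

-- These copies address the cheat sheet, so the output is the whole tuple of values.
power : Prob Bool → ∀ c → Prob (Vec Bool c)
power P zero .fam k []    = one []
power P zero .cover α     = [] , λ k → [] , here , []
power P zero .opp {[]} {[]} n = ⊥-elim (n refl)
power P zero .hit []      = tt
power P (suc c) .fam k (b ∷ o) = liftᵗ false (fam P k b) ⊛ liftᵗ true (fam (power P c) k o)
power P (suc c) .cover α =
  let b , σ = cover P (λ v → α (false ∷ v))
      o , τ = cover (power P c) (λ v → α (true ∷ v))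
  in b ∷ o , λ k → ⊨∃-⊛ (⊨∃-lift false (σ k)) (⊨∃-lift true (τ k))
power P (suc c) .opp {b ∷ o} {b' ∷ o'} n k k' p q
  with ∈-⊛⁻ (liftᵗ false (fam P k b)) (liftᵗ true (fam (power P c) k o)) p
     | ∈-⊛⁻ (liftᵗ false (fam P k' b')) (liftᵗ true (fam (power P c) k' o')) q
... | mk {x} p₁ p₂ | mk {y} q₁ q₂
  with _ , p₁' , refl ← ∈-mapᵗ⁻ (fam P k b) p₁ | _ , q₁' , refl ← ∈-mapᵗ⁻ (fam P k' b') q₁
     | _ , p₂' , refl ← ∈-mapᵗ⁻ (fam (power P c) k o) p₂
     | _ , q₂' , refl ← ∈-mapᵗ⁻ (fam (power P c) k' o') q₂
  with b ≟ᵇ b'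
... | no b≢b' = Conf-⊆ ∈-++⁺ˡ ∈-++⁺ˡ (Conf-lift false (opp P b≢b' k k' p₁' q₁'))
... | yes refl = Conf-⊆ (∈-++⁺ʳ x) (∈-++⁺ʳ y)
  (Conf-lift true (opp (power P c) (λ e → n (cong (b ∷_) e)) k k' p₂' q₂'))
power P (suc c) .hit (b ∷ o) =
  Hit-⊛ _ _ (Hit-lift false _ (hit P b)) (Hit-lift true _ (hit (power P c) o))

power-zero-Hard : ∀ P d {S : Valuation → Set} {α} → S α → Hard (power P zero) d S
power-zero-Hard P zero    s = tt
power-zero-Hard P (suc d) {α = α} s =
  (λ { [] → α , s , λ k → [] , here , [] }) , λ v → α v , power-zero-Hard P d (s , refl)

-- Every tuple must stay possible, so all copies have to stay undecided and the hardness does not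
-- add up: a query to one half also lowers the budget of the other.
power-suc-Hard : ∀ P c d {S T} → Hard P d S → Hard (power P c) d T → Hard (power P (suc c)) d (S ⊠ T)
power-suc-Hard P c zero    h h' = tt
power-suc-Hard P c (suc d) {S} {T} h@(o , q) h'@(o' , q') = vals , ask
  where
  Q = power P (suc c)
  vals : ∀ x → Σ Valuation λ γ → (S ⊠ T) γ × Value Q γ x
  vals (b ∷ x) = let α , s , σ = o b ; β , t , τ = o' x in
    join α β , (refl , s , t) , λ k → ⊨∃-⊛ (⊨∃-lift false (σ k)) (⊨∃-lift true (τ k))
  ask : ∀ v → Σ Bool λ b → Hard Q d ((S ⊠ T) ∩[ v ≔ b ])
  ask [] = false , Hard-⊆ Q d (λ u → u , proj₁ u)
    (power-suc-Hard P c d {S} {T} (Hard-pred P d h) (Hard-pred (power P c) d h'))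
  ask (false ∷ v) with b , k ← q v = b , Hard-⊆ Q d (λ (e , (u , e') , w) → (e , u , w) , e')
    (power-suc-Hard P c d {S ∩[ v ≔ b ]} {T} k (Hard-pred (power P c) d h'))
  ask (true ∷ v) with b , k ← q' v = b , Hard-⊆ Q d (λ (e , u , w , e') → (e , u , w) , e')
    (power-suc-Hard P c d {S} {T ∩[ v ≔ b ]} (Hard-pred P d h) k)

power-Hard : ∀ P c d → Hard P d All-valuations → Hard (power P c) d All-valuations
power-Hard P zero    d h = power-zero-Hard P d {α = λ _ → false} tt
power-Hard P (suc c) d h = Hard-⊆ (power P (suc c)) d (λ _ → tt)
  (power-suc-Hard P c d h (power-Hard P c d h))

-- Decision trees

data DecisionTree : Set where
  leaf : Bool → DecisionTree
  node : Var → DecisionTree → DecisionTree → DecisionTree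

choose : ∀ {A : Set} → Bool → A → A → A
choose false x y = x
choose true  x y = y

choose-false : ∀ {A : Set} {b} {x y : A} → b ≡ false → choose b x y ≡ x
choose-false refl = refl

choose-true : ∀ {A : Set} {b} {x y : A} → b ≡ true → choose b x y ≡ y
choose-true refl = refl

eval : Valuation → DecisionTree → Bool
eval α (leaf b)     = b
eval α (node v s t) = choose (α v) (eval α s) (eval α t)

-- Paths that read a variable twice with different answers are kept; no valuation satisfies them.
branches : Bool → DecisionTree → Tree Term
branches b (leaf c) with b ≟ᵇ c
... | yes _ = one []
... | no  _ = ∅
branches b (node v s t) = mapᵗ ((v , false) ∷_) (branches b s) ⋎ mapᵗ ((v , true) ∷_) (branches b t)

branches-eval : ∀ {α b} D → eval α D ≡ b → α ⊨∃ branches b D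
branches-eval {b = b} (leaf c) e with b ≟ᵇ c
... | yes _ = [] , here , []
... | no  n = ⊥-elim (n (sym e))
branches-eval {α} (node v s t) e with α v in eq
... | false = let x , p , σ = branches-eval s e in _ , left (∈-bind⁺ p here) , eq ∷ σ
... | true  = let x , p , σ = branches-eval t e in _ , right (∈-bind⁺ p here) , eq ∷ σ

Conf-∷ : ∀ l l' {x y} → Conf x y → Conf (l ∷ x) (l' ∷ y)
Conf-∷ _ _ = Conf-⊆ there there

-- Paths to different leaves part at some node and conflict in the variable read there.
branches-opp : ∀ {b b'} → ¬ (b ≡ b') → ∀ D {x y} →
  x ∈ᵗ branches b D → y ∈ᵗ branches b' D → Conf x y
branches-opp {b} {b'} n (leaf c) p q with b ≟ᵇ c | b' ≟ᵇ c
... | yes refl | yes refl = ⊥-elim (n refl)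
branches-opp n (node v s t) (left p) (left q)
  with _ , p' , refl ← ∈-mapᵗ⁻ (branches _ s) p | _ , q' , refl ← ∈-mapᵗ⁻ (branches _ s) q =
  Conf-∷ _ _ (branches-opp n s p' q')
branches-opp n (node v s t) (left p) (right q)
  with _ , p' , refl ← ∈-mapᵗ⁻ (branches _ s) p | _ , q' , refl ← ∈-mapᵗ⁻ (branches _ t) q =
  v , false , here refl , here refl
branches-opp n (node v s t) (right p) (left q)
  with _ , p' , refl ← ∈-mapᵗ⁻ (branches _ t) p | _ , q' , refl ← ∈-mapᵗ⁻ (branches _ s) q =
  v , true , here refl , here refl
branches-opp n (node v s t) (right p) (right q)
  with _ , p' , refl ← ∈-mapᵗ⁻ (branches _ t) p | _ , q' , refl ← ∈-mapᵗ⁻ (branches _ t) q =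
  Conf-∷ _ _ (branches-opp n t p' q')

branches-hit : ∀ b D → Hit (branches b D)
branches-hit b (leaf c) with b ≟ᵇ c
... | yes _ = tt
... | no  _ = tt
branches-hit b (node v s t) =
  Hit-mapᵗ (Conf-∷ _ _) _ (branches-hit b s) , Hit-mapᵗ (Conf-∷ _ _) _ (branches-hit b t) , cross
  where
  cross : ∀ {x y} → x ∈ᵗ mapᵗ ((v , false) ∷_) (branches b s) →
    y ∈ᵗ mapᵗ ((v , true) ∷_) (branches b t) → Conf x y
  cross p q with _ , _ , refl ← ∈-mapᵗ⁻ (branches b s) p | _ , _ , refl ← ∈-mapᵗ⁻ (branches b t) q =
    v , false , here refl , here refl

data Height : ℕ → DecisionTree → Set where
  leaf : ∀ {h b} → Height h (leaf b)
  node : ∀ {h v s t} → Height h s → Height h t → Height (suc h) (node v s t)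

Height-≤ : ∀ {h h' D} → h ≤ h' → Height h D → Height h' D
Height-≤ p       leaf       = leaf
Height-≤ (s≤s p) (node s t) = node (Height-≤ p s) (Height-≤ p t)

branches-Bounded : ∀ {h D} b → Height h D → Bounded h h (branches b D)
branches-Bounded {D = leaf c} b leaf with b ≟ᵇ c
... | yes _ = one z≤n
... | no  _ = ∅
branches-Bounded b (node s t) =
  Bounded-mapᵗ (λ _ → s≤s) (branches-Bounded b s) ⋎ Bounded-mapᵗ (λ _ → s≤s) (branches-Bounded b t)

check : Term → DecisionTree
check []              = leaf true
check ((v , b) ∷ t) = node v (choose b (check t) (leaf false)) (choose b (leaf false) (check t))

check-eval : ∀ {α t} → α ⊨ t → eval α (check t) ≡ true
check-eval [] = refl
check-eval {α} {(v , false) ∷ t} (e ∷ σ) rewrite e = check-eval σ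
check-eval {α} {(v , true)  ∷ t} (e ∷ σ) rewrite e = check-eval σ

check-height : ∀ t → Height (length t) (check t)
check-height []                = leaf
check-height ((v , false) ∷ t) = node (check-height t) leaf
check-height ((v , true)  ∷ t) = node leaf (check-height t)

check-⊆ : ∀ t {x} → x ∈ᵗ branches true (check t) → t ⊆ᵗ x
check-⊆ ((v , false) ∷ t) (left p) m with _ , p' , refl ← ∈-mapᵗ⁻ (branches true (check t)) p | m
... | here e = here e
... | there m' = there (check-⊆ t p' m')
check-⊆ ((v , true) ∷ t) (right p) m with _ , p' , refl ← ∈-mapᵗ⁻ (branches true (check t)) p | m
... | here e = here e
... | there m' = there (check-⊆ t p' m')

-- Reads the address of a term of the family from the bits ρ 0, ρ 1, …, then checks that term.
lookupCheck : (ℕ → Var) → Tree Term → DecisionTree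
lookupCheck ρ ∅       = leaf false
lookupCheck ρ (one t) = check t
lookupCheck ρ (s ⋎ t) = node (ρ 0) (lookupCheck (ρ ∘ suc) s) (lookupCheck (ρ ∘ suc) t)

lookupCheck-height : ∀ {d w T} ρ → Bounded d w T → Height (d + w) (lookupCheck ρ T)
lookupCheck-height ρ ∅ = leaf
lookupCheck-height {d} ρ (one {x = x} p) = Height-≤ (≤-trans p (m≤n+m _ d)) (check-height x)
lookupCheck-height ρ (s ⋎ t) = node (lookupCheck-height _ s) (lookupCheck-height _ t)

lookupCheck-⊆ : ∀ ρ T {x} → x ∈ᵗ branches true (lookupCheck ρ T) → Σ Term λ t → t ∈ᵗ T × t ⊆ᵗ x
lookupCheck-⊆ ρ (one t) p = t , here , check-⊆ t p
lookupCheck-⊆ ρ (s ⋎ t) (left p)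
  with _ , p' , refl ← ∈-mapᵗ⁻ (branches true (lookupCheck (ρ ∘ suc) s)) p
  with u , m , i ← lookupCheck-⊆ _ s p' = u , left m , there ∘ i
lookupCheck-⊆ ρ (s ⋎ t) (right p)
  with _ , p' , refl ← ∈-mapᵗ⁻ (branches true (lookupCheck (ρ ∘ suc) t)) p
  with u , m , i ← lookupCheck-⊆ _ t p' = u , right m , there ∘ i

-- `η` is the address of `t`, continued by false. It is chosen before `α`, because the adversary
-- builds `α` by writing `η` into a cell.
lookupCheck-eval : ∀ {t T} → t ∈ᵗ T → Σ (ℕ → Bool) λ η → ∀ {α} ρ →
  (∀ n → α (ρ n) ≡ η n) → α ⊨ t → eval α (lookupCheck ρ T) ≡ true
lookupCheck-eval here = (λ _ → false) , λ ρ e σ → check-eval σ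
lookupCheck-eval (left p) with η , f ← lookupCheck-eval p =
  (λ { zero → false ; (suc n) → η n }) ,
  λ ρ e σ → trans (choose-false (e 0)) (f (ρ ∘ suc) (e ∘ suc) σ)
lookupCheck-eval (right p) with η , f ← lookupCheck-eval p =
  (λ { zero → true ; (suc n) → η n }) ,
  λ ρ e σ → trans (choose-true (e 0)) (f (ρ ∘ suc) (e ∘ suc) σ)

-- Unions over addresses and untouched cells

⋃ : ∀ c → (Vec Bool c → Tree Term) → Tree Term
⋃ zero    f = f []
⋃ (suc c) f = ⋃ c (f ∘ (false ∷_)) ⋎ ⋃ c (f ∘ (true ∷_))

∈-⋃⁺ : ∀ {c f x} o → x ∈ᵗ f o → x ∈ᵗ ⋃ c f
∈-⋃⁺ []          p = p
∈-⋃⁺ (false ∷ o) p = left (∈-⋃⁺ o p)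
∈-⋃⁺ (true ∷ o)  p = right (∈-⋃⁺ o p)

∈-⋃⁻ : ∀ c {f x} → x ∈ᵗ ⋃ c f → Σ (Vec Bool c) λ o → x ∈ᵗ f o
∈-⋃⁻ zero p = [] , p
∈-⋃⁻ (suc c) (left p)  = let o , q = ∈-⋃⁻ c p in false ∷ o , q
∈-⋃⁻ (suc c) (right p) = let o , q = ∈-⋃⁻ c p in true ∷ o , q

Hit-⋃ : ∀ c {f} → (∀ o → Hit (f o)) →
  (∀ {o o' x y} → ¬ (o ≡ o') → x ∈ᵗ f o → y ∈ᵗ f o' → Conf x y) → Hit (⋃ c f)
Hit-⋃ zero    h n = h []
Hit-⋃ (suc c) h n =
  Hit-⋃ c (h ∘ (false ∷_)) (λ o≢o' → n (o≢o' ∘ Vec.∷-injectiveʳ)) ,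
  Hit-⋃ c (h ∘ (true ∷_)) (λ o≢o' → n (o≢o' ∘ Vec.∷-injectiveʳ)) ,
  λ p q → n (λ ()) (proj₂ (∈-⋃⁻ c p)) (proj₂ (∈-⋃⁻ c q))

Bounded-⋃ : ∀ c {f d w} → (∀ o → Bounded d w (f o)) → Bounded (c + d) w (⋃ c f)
Bounded-⋃ zero    h = h []
Bounded-⋃ (suc c) h = Bounded-⋃ c (h ∘ (false ∷_)) ⋎ Bounded-⋃ c (h ∘ (true ∷_))

-- The leading `true` selects the half that holds the cells; after the address `o`, the index of the
-- bit is written in unary.
cellVar : ∀ {c} → Vec Bool c → ℕ → Var
cellVar o n = true ∷ (toList o ++ replicate n false)

strip : ∀ {c} → Vec Bool c → Var → Maybe Var
strip []      q       = just q
strip (b ∷ o) []      = nothing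
strip (b ∷ o) (b' ∷ q) with b ≟ᵇ b'
... | yes _ = strip o q
... | no  _ = nothing

strip-toList : ∀ {c} (o : Vec Bool c) q → strip o (toList o ++ q) ≡ just q
strip-toList []      q = refl
strip-toList (b ∷ o) q with b ≟ᵇ b
... | yes _ = strip-toList o q
... | no n  = ⊥-elim (n refl)

tails : Bool → List Var → List Var
tails b []            = []
tails b ([] ∷ L)      = tails b L
tails b ((b' ∷ q) ∷ L) with b ≟ᵇ b'
... | yes _ = q ∷ tails b L
... | no  _ = tails b L

length-tails : ∀ L → length (tails false L) + length (tails true L) ≤ length L
length-tails []                = z≤n
length-tails ([] ∷ L)          = ≤-trans (length-tails L) (n≤1+n _)
length-tails ((false ∷ q) ∷ L) = s≤s (length-tails L)
length-tails ((true ∷ q) ∷ L)  =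
  ≤-trans (≤-reflexive (+-suc (length (tails false L)) _)) (s≤s (length-tails L))

Untouched : ∀ {c} → Vec Bool c → List Var → Set
Untouched o L = ∀ {q} → q ∈ L → strip o q ≡ nothing

untouched-∷ : ∀ {c} b (o : Vec Bool c) L → Untouched o (tails b L) → Untouched (b ∷ o) L
untouched-∷ b o ([] ∷ L) u (here refl) = refl
untouched-∷ b o ([] ∷ L) u (there m) = untouched-∷ b o L u m
untouched-∷ b o ((b' ∷ q) ∷ L) u (here refl) with b ≟ᵇ b'
... | yes _ = u (here refl)
... | no  _ = refl
untouched-∷ b o ((b' ∷ q) ∷ L) u (there m) with b ≟ᵇ b'
... | yes _ = untouched-∷ b o L (u ∘ there) m
... | no  _ = untouched-∷ b o L u m

-- Pigeonhole by bisection: of fewer than `2 ^ suc c` variables, fewer than `2 ^ c` fall into one of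
-- the two halves.
untouched : ∀ c L → length L < 2 ^ c → Σ (Vec Bool c) λ o → Untouched o L
untouched zero []          _ = [] , λ ()
untouched zero (_ ∷ _) (s≤s ())
untouched (suc c) L l< with length (tails false L) <? 2 ^ c
... | yes p = let o , u = untouched c (tails false L) p in false ∷ o , untouched-∷ false o L u
... | no ¬p = let o , u = untouched c (tails true L) l' in true ∷ o , untouched-∷ true o L u
  where
  l' : length (tails true L) < 2 ^ c
  l' = +-cancelˡ-< (2 ^ c) _ _ (≤-<-trans
    (≤-trans (+-monoˡ-≤ _ (≮⇒≥ ¬p)) (length-tails L))
    (subst (length L <_) (cong (2 ^ c +_) (+-identityʳ (2 ^ c))) l<))

-- The cheat sheet function

-- The alternative ∅ in `sheet` supplies a flag bit whose value false makes the cell invalid.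
module _ {c : ℕ} (Q : Prob (Vec Bool c)) where

  sheet : Vec Bool c → DecisionTree
  sheet o = lookupCheck (cellVar o) (∅ ⋎ liftᵗ false (fam Q cert o))

  falses : Kind → Vec Bool c → Tree Term
  falses k o = liftᵗ false (fam Q k o) ⊛ branches false (sheet o)

  -- For true both kinds coincide: an accepting path already contains a certificate of the address,
  -- so these terms are unambiguous at the price of the `cert` families.
  cheatFam : Kind → Bool → Tree Term
  cheatFam k true  = ⋃ c λ o → branches true (sheet o)
  cheatFam k false = ⋃ c (falses k)

  cheat-value : ∀ {α o} → Value Q (λ v → α (false ∷ v)) o → ∀ {b} → eval α (sheet o) ≡ b →
    ∀ k → α ⊨∃ cheatFam k b
  cheat-value {o = o} σ {true} e k =
    let x , p , τ = branches-eval (sheet o) e in x , ∈-⋃⁺ o p , τ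
  cheat-value {o = o} σ {false} e k =
    let x , p , τ = ⊨∃-⊛ (⊨∃-lift false (σ k)) (branches-eval (sheet o) e) in x , ∈-⋃⁺ o p , τ

  sheet-cert : ∀ o {x} → x ∈ᵗ branches true (sheet o) →
    Σ Term λ t → t ∈ᵗ fam Q cert o × lift false t ⊆ᵗ x
  sheet-cert o p with lookupCheck-⊆ (cellVar o) (∅ ⋎ liftᵗ false (fam Q cert o)) p
  -- An accepting path has the flag true, since the other branch rejects.
  ... | _ , right m , i with t , m' , refl ← ∈-mapᵗ⁻ (fam Q cert o) m = t , m' , i

  falses-fam : ∀ k o {x} → x ∈ᵗ falses k o → Σ Term λ t → t ∈ᵗ fam Q k o × lift false t ⊆ᵗ x
  falses-fam k o p with ∈-⊛⁻ (liftᵗ false (fam Q k o)) (branches false (sheet o)) p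
  ... | mk a b with t , m , refl ← ∈-mapᵗ⁻ (fam Q k o) a = t , m , ∈-++⁺ˡ

  fam-opp : ∀ {o o' k k' x y} → ¬ (o ≡ o') →
    (Σ Term λ t → t ∈ᵗ fam Q k o × lift false t ⊆ᵗ x) →
    (Σ Term λ t → t ∈ᵗ fam Q k' o' × lift false t ⊆ᵗ y) → Conf x y
  fam-opp n (s , p , i) (t , q , j) = Conf-⊆ i j (Conf-lift false (opp Q n _ _ p q))

  -- Different addresses conflict through their certificates; at the same address, an accepting and
  -- a rejecting path of one sheet conflict.
  cheat-opp : ∀ k k' {s t} → s ∈ᵗ cheatFam k true → t ∈ᵗ cheatFam k' false → Conf s t
  cheat-opp k k' p q with o , p' ← ∈-⋃⁻ c p | o' , q' ← ∈-⋃⁻ c q with Vec.≡-dec _≟ᵇ_ o o'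
  ... | no o≢o' = fam-opp o≢o' (sheet-cert o p') (falses-fam k' o' q')
  ... | yes refl with ∈-⊛⁻ (liftᵗ false (fam Q k' o)) (branches false (sheet o)) q'
  ...   | mk {x} a b = Conf-⊆ (λ z → z) (∈-++⁺ʳ x) (branches-opp (λ ()) (sheet o) p' b)

  cheat : Prob Bool
  cheat .fam = cheatFam
  cheat .cover α = let o , σ = cover Q (λ v → α (false ∷ v)) in eval α (sheet o) , cheat-value σ refl
  cheat .opp {true}  {true}  n k k' p q = ⊥-elim (n refl)
  cheat .opp {true}  {false} n k k' p q = cheat-opp k k' p q
  cheat .opp {false} {true}  n k k' p q = Conf-sym (cheat-opp k' k q p)
  cheat .opp {false} {false} n k k' p q = ⊥-elim (n refl)
  cheat .hit true = Hit-⋃ c (λ o → branches-hit true (sheet o))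
    λ {o} {o'} n p q → fam-opp n (sheet-cert o p) (sheet-cert o' q)
  cheat .hit false = Hit-⋃ c
    (λ o → Hit-⊛ _ _ (Hit-lift false _ (hit Q o)) (branches-hit false (sheet o)))
    λ {o} {o'} n p q → fam-opp n (falses-fam part o p) (falses-fam part o' q)

  Zero-on : List Var → Valuation → Set
  Zero-on L β = ∀ q → q ∈ L → β q ≡ false

  -- Writes `η` into cell `o` and false elsewhere. The length of the remainder is the unary index of
  -- the bit.
  fill : Vec Bool c → (ℕ → Bool) → Valuation
  fill o η q with strip o q
  ... | just r  = η (length r)
  ... | nothing = false

  fill-cell : ∀ o η n → fill o η (toList o ++ replicate n false) ≡ η n
  fill-cell o η n rewrite strip-toList o (replicate n false) = cong η (length-replicate n)

  fill-untouched : ∀ o η {L} → Untouched o L → Zero-on L (fill o η)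
  fill-untouched o η u q m rewrite u m = refl

  -- The adversary answers false in the cells; fewer than 2 ^ c queries leave a cell untouched.
  cheat-Hard′ : ∀ d L {S} → length L + d ≤ 2 ^ c → Hard Q d S → Hard cheat d (S ⊠ Zero-on L)
  cheat-Hard′ zero    L {S} l≤ h = tt
  cheat-Hard′ (suc d) L {S} l≤ h@(o , q) = vals , ask
    where
    l≤' : suc (length L + d) ≤ 2 ^ c
    l≤' = ≤-trans (≤-reflexive (sym (+-suc (length L) d))) l≤
    vals : ∀ b → Σ Valuation λ γ → (S ⊠ Zero-on L) γ × Value cheat γ b
    -- The address is steered to an untouched cell `i`: left all false it gives output false, filled
    -- with the position of a certificate it gives true.
    vals b with i , u ← untouched c L (≤-trans (s≤s (m≤m+n _ d)) l≤') with α , s , σ ← o i with b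
    ... | false = join α (λ _ → false) , (refl , s , λ _ _ → refl) , cheat-value σ refl
    ... | true with t , m , τ ← σ cert
               with η , f ← lookupCheck-eval {T = ∅ ⋎ liftᵗ false (fam Q cert i)}
                              (right (∈-bind⁺ m here)) =
      join α (fill i η) , (refl , s , fill-untouched i η u) ,
      cheat-value σ (f (cellVar i) (fill-cell i η) (All.map⁺ τ))
    ask : ∀ v → Σ Bool λ b → Hard cheat d ((S ⊠ Zero-on L) ∩[ v ≔ b ])
    ask [] = false , Hard-⊆ cheat d (λ w → w , proj₁ w)
      (cheat-Hard′ d L {S} (≤-trans (n≤1+n _) l≤') (Hard-pred Q d h))
    ask (false ∷ v) with b , h' ← q v = b , Hard-⊆ cheat d (λ (e , (w , e') , z) → (e , w , z) , e')
      (cheat-Hard′ d L {S ∩[ v ≔ b ]} (≤-trans (n≤1+n _) l≤') h')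
    ask (true ∷ v) = false ,
      Hard-⊆ cheat d (λ (e , w , z) → (e , w , λ q m → z q (there m)) , z v (here refl))
        (cheat-Hard′ d (v ∷ L) {S} l≤' (Hard-pred Q d h))

  cheat-Hard : ∀ d → d ≤ 2 ^ c → Hard Q d All-valuations → Hard cheat d All-valuations
  cheat-Hard d d≤ h = Hard-⊆ cheat d (λ _ → tt) (cheat-Hard′ d [] d≤ h)

-- Substitution of an exclusive or

infixr 6 _⊻_
_⊻_ : Bool → Bool → Bool
false ⊻ b = b
true  ⊻ b = neg b

⊻-neg : ∀ a b → a ⊻ neg b ≡ neg (a ⊻ b)
⊻-neg false b = refl
⊻-neg true  b = refl

⊻-self : ∀ a b → (a ⊻ b) ⊻ b ≡ a
⊻-self false false = refl
⊻-self false true  = refl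
⊻-self true  false = refl
⊻-self true  true  = refl

⊻-cancel : ∀ a b → a ⊻ (a ⊻ b) ≡ b
⊻-cancel false b = refl
⊻-cancel true  b = neg-involutive b

-- Every variable v is replaced by the exclusive or of two variables, false ∷ v and true ∷ v.
split : Var → Bool → Bool → Term → Term
split v b z t = (false ∷ v , z) ∷ (true ∷ v , z ⊻ b) ∷ t

expand : Term → Tree Term
expand []            = one []
expand ((v , b) ∷ t) = mapᵗ (split v b false) (expand t) ⋎ mapᵗ (split v b true) (expand t)

expand-∈ : ∀ {v b t x} → (v , b) ∈ t → x ∈ᵗ expand t →
  Σ Bool λ z → (false ∷ v , z) ∈ x × (true ∷ v , z ⊻ b) ∈ x
expand-∈ {t = _ ∷ t} (here refl) (left p) with _ , _ , refl ← ∈-mapᵗ⁻ (expand t) p =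
  false , here refl , there (here refl)
expand-∈ {t = _ ∷ t} (here refl) (right p) with _ , _ , refl ← ∈-mapᵗ⁻ (expand t) p =
  true , here refl , there (here refl)
expand-∈ {t = _ ∷ t} (there m) (left p) with _ , p' , refl ← ∈-mapᵗ⁻ (expand t) p =
  let z , q , r = expand-∈ m p' in z , there (there q) , there (there r)
expand-∈ {t = _ ∷ t} (there m) (right p) with _ , p' , refl ← ∈-mapᵗ⁻ (expand t) p =
  let z , q , r = expand-∈ m p' in z , there (there q) , there (there r)

-- If the expansions agree on the first variable of the conflicting pair, they differ on the second,
-- because their exclusive ors differ.
expand-Conf : ∀ {s t x y} → Conf s t → x ∈ᵗ expand s → y ∈ᵗ expand t → Conf x y
expand-Conf {y = y} (v , b , m , n) p q
  with z , p₁ , p₂ ← expand-∈ m p | z' , q₁ , q₂ ← expand-∈ n q with z ≟ᵇ z'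
... | yes refl = true ∷ v , z ⊻ b , p₂ , subst (λ c → (true ∷ v , c) ∈ y) (⊻-neg z b) q₂
... | no z≢z'  = false ∷ v , z , p₁ , subst (λ c → (false ∷ v , c) ∈ y) (≢⇒≡neg z≢z') q₁

expand-Hit : ∀ t → Hit (expand t)
expand-Hit []            = tt
expand-Hit ((v , b) ∷ t) =
  Hit-mapᵗ Conf-split _ (expand-Hit t) ,
  Hit-mapᵗ Conf-split _ (expand-Hit t) , cross
  where
  Conf-split : ∀ {c x y} → Conf x y → Conf (split v b c x) (split v b c y)
  Conf-split = Conf-⊆ (there ∘ there) (there ∘ there)
  cross : ∀ {x y} → x ∈ᵗ mapᵗ (split v b false) (expand t) →
    y ∈ᵗ mapᵗ (split v b true) (expand t) → Conf x y
  cross p q with _ , _ , refl ← ∈-mapᵗ⁻ (expand t) p | _ , _ , refl ← ∈-mapᵗ⁻ (expand t) q =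
    false ∷ v , false , here refl , here refl

expand-Bounded : ∀ t → Bounded (length t) (2 * length t) (expand t)
expand-Bounded []            = one z≤n
expand-Bounded ((v , b) ∷ t) =
  Bounded-mapᵗ (grow false) (expand-Bounded t) ⋎ Bounded-mapᵗ (grow true) (expand-Bounded t)
  where
  grow : ∀ z x → length x ≤ 2 * length t → length (split v b z x) ≤ 2 * suc (length t)
  grow z x p = ≤-trans (s≤s (s≤s p)) (≤-reflexive (sym (*-suc 2 (length t))))

-- The point whose pairs have first members `ξ` and exclusive ors `α`; `[]` is in no pair and gets a
-- default.
blend : Valuation → Valuation → Valuation
blend α ξ []          = false
blend α ξ (false ∷ v) = ξ v
blend α ξ (true  ∷ v) = ξ v ⊻ α v

expand-sat : ∀ {α γ t} → (∀ v → γ (true ∷ v) ≡ γ (false ∷ v) ⊻ α v) → α ⊨ t → γ ⊨∃ expand t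
expand-sat g [] = [] , here , []
expand-sat {γ = γ} {(v , b) ∷ t} g (e ∷ σ)
  with γ (false ∷ v) in eq | trans (g v) (cong (γ (false ∷ v) ⊻_) e) | expand-sat g σ
... | false | e' | x , p , τ = _ , left (∈-bind⁺ p here) , eq ∷ e' ∷ τ
... | true  | e' | x , p , τ = _ , right (∈-bind⁺ p here) , eq ∷ e' ∷ τ

-- From terms to clauses

-- `ℕᵇ` is bijective base two, so its constructors match those of bit lists.
fromBits : Var → ℕᵇ
fromBits []          = ℕᵇ.zero
fromBits (false ∷ v) = 2[1+ fromBits v ]
fromBits (true  ∷ v) = 1+[2 fromBits v ]

toBits : ℕᵇ → Var
toBits ℕᵇ.zero  = []
toBits 2[1+ x ] = false ∷ toBits x
toBits 1+[2 x ] = true ∷ toBits x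

toBits-fromBits : ∀ v → toBits (fromBits v) ≡ v
toBits-fromBits []          = refl
toBits-fromBits (false ∷ v) = cong (false ∷_) (toBits-fromBits v)
toBits-fromBits (true  ∷ v) = cong (true ∷_) (toBits-fromBits v)

encode : Var → ℕ
encode v = toℕ (fromBits v)

decode : ℕ → Var
decode n = toBits (fromℕ n)

decode-encode : ∀ v → decode (encode v) ≡ v
decode-encode v = trans (cong toBits (fromℕ-toℕ (fromBits v))) (toBits-fromBits v)

-- A clause excludes the subcube on which its term holds, hence the opposite polarity.
negate : Var × Bool → Literal
negate (v , b) = lit (encode v) (neg b)

clause : Term → Clause
clause = map negate

flatten : ∀ {A} → Tree A → List A
flatten ∅       = []
flatten (one x) = x ∷ []
flatten (s ⋎ t) = flatten s ++ flatten t

∈-flatten⁺ : ∀ {A} {x : A} {t} → x ∈ᵗ t → x ∈ flatten t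
∈-flatten⁺ here          = here refl
∈-flatten⁺ (left p)      = ∈-++⁺ˡ (∈-flatten⁺ p)
∈-flatten⁺ {t = s ⋎ t} (right p) = ∈-++⁺ʳ (flatten s) (∈-flatten⁺ p)

∈-flatten⁻ : ∀ {A} {x : A} t → x ∈ flatten t → x ∈ᵗ t
∈-flatten⁻ (one x) (here refl) = here
∈-flatten⁻ (s ⋎ t) p with ∈-++⁻ (flatten s) p
... | inj₁ q = left (∈-flatten⁻ s q)
... | inj₂ q = right (∈-flatten⁻ t q)

length-flatten : ∀ {d w t} → Bounded d w t → length (flatten t) ≤ 2 ^ d
length-flatten ∅ = z≤n
length-flatten {d} (one _) = m^n>0 2 d
length-flatten {suc d} (_⋎_ {s = s} a b) = ≤-trans (≤-reflexive (length-++ (flatten s)))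
  (+-mono-≤ (length-flatten a) (≤-trans (length-flatten b) (≤-reflexive (sym (+-identityʳ _)))))

flatten-width : ∀ {d w t} → Bounded d w t → All (λ x → length x ≤ w) (flatten t)
flatten-width ∅       = []
flatten-width (one p) = p ∷ []
flatten-width (a ⋎ b) = All.++⁺ (flatten-width a) (flatten-width b)

flatten-Conf : ∀ t → Hit t → AllPairs Conf (flatten t)
flatten-Conf ∅       h = []
flatten-Conf (one x) h = [] ∷ []
flatten-Conf (s ⋎ t) (hs , ht , st) = AllPairs.++⁺ (flatten-Conf s hs) (flatten-Conf t ht)
  (All.tabulate λ p → All.tabulate λ q → st (∈-flatten⁻ s p) (∈-flatten⁻ t q))

-- The formula and its tree-like refutations

module _ (P : Prob Bool) where

  parts : Tree Term
  parts = fam P part false ⋎ fam P part true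

  parts-∈ : ∀ {t} → t ∈ᵗ parts → Σ Bool λ b → t ∈ᵗ fam P part b
  parts-∈ (left p)  = false , p
  parts-∈ (right p) = true , p

  ∈-parts : ∀ {t} b → t ∈ᵗ fam P part b → t ∈ᵗ parts
  ∈-parts false = left
  ∈-parts true  = right

  formula : CNF
  formula = map clause (flatten (bind parts expand))

  parts-Hit : Hit (bind parts expand)
  parts-Hit = Hit-bind parts (hit P false , hit P true , opp P (λ ()) part part)
    expand-Hit expand-Conf

  formula-Hitting : Hitting formula
  formula-Hitting = hitting (AllPairs.map⁺ (AllPairs.map clash (flatten-Conf _ parts-Hit)))
    where
    Clash : Clause → Clause → Set
    Clash C D = ∃[ l ] (l ∈ C × comp l ∈ D)
    clash : ∀ {s t} → Conf s t → Clash (clause s) (clause t)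
    clash (v , b , p , q) = _ , ∈-map⁺ negate p , ∈-map⁺ negate q
    Clash-sym : ∀ {C D} → Clash C D → Clash D C
    Clash-sym {C} (lit x b , p , q) =
      _ , q , subst (λ c → lit x c ∈ C) (sym (neg-involutive b)) p
    hitting : ∀ {F} → AllPairs Clash F → Hitting F
    hitting (_ ∷ _)  zero    zero    i≢j = ⊥-elim (i≢j refl)
    hitting (px ∷ _) zero    (suc j) i≢j = All.lookup px (∈-lookup j)
    hitting (px ∷ _) (suc i) zero    i≢j = Clash-sym (All.lookup px (∈-lookup i))
    hitting (_ ∷ ps) (suc i) (suc j) i≢j = hitting ps i j (i≢j ∘ cong suc)

  -- The exclusive ors under any assignment form a point covered by some part; the satisfied
  -- expansion of that part is a falsified clause.
  formula-Unsat : Unsatisfiable formula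
  formula-Unsat α sat = clash (All.lookup sat (∈-map⁺ clause (∈-flatten⁺ (∈-bind⁺ (∈-parts o p) p')))) σ'
    where
    γ : Valuation
    γ v = α (encode v)
    o = proj₁ (cover P λ v → γ (false ∷ v) ⊻ γ (true ∷ v))
    tσ = proj₂ (cover P λ v → γ (false ∷ v) ⊻ γ (true ∷ v)) part
    p = proj₁ (proj₂ tσ)
    xσ = expand-sat {γ = γ} (λ v → sym (⊻-cancel (γ (false ∷ v)) _)) (proj₂ (proj₂ tσ))
    p' = proj₁ (proj₂ xσ)
    σ' = proj₂ (proj₂ xσ)
    clash : ∀ {t} → SatClause α (clause t) → γ ⊨ t → ⊥
    clash {_ ∷ _} (here e)  (e' ∷ _) = b≢neg-b (trans (sym e') e)
    clash {_ ∷ _} (there s) (_ ∷ σ)  = clash s σ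

  Falsified : Valuation → Clause → Set
  Falsified γ C = ∀ {l} → l ∈ C → γ (decode (var l)) ≡ neg (pol l)

  Falsified-clause : ∀ {γ t} → Falsified γ (clause t) → γ ⊨ t
  Falsified-clause {γ} f = All.tabulate λ {(v , b)} m →
    trans (cong γ (sym (decode-encode v))) (trans (f (∈-map⁺ negate m)) (neg-involutive b))

  infix 4 _≟ˡ_
  _≟ˡ_ : (k l : Literal) → Dec (k ≡ l)
  lit x b ≟ˡ lit y c with x ≟ y | b ≟ᵇ c
  ... | yes refl | yes refl = yes refl
  ... | no n     | _        = no λ { refl → n refl }
  ... | _        | no n     = no λ { refl → n refl }

  -- Descent in the refutation: the value of the pivot selects a premise that is falsified as well.
  Falsified-premiseˡ : ∀ {A B C l} γ → IsResolvent A B l C → Falsified γ C →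
    γ (decode (var l)) ≡ neg (pol l) → Falsified γ A
  Falsified-premiseˡ {l = l} γ (_ , _ , r) f e {k} m with k ≟ˡ l
  ... | yes refl = e
  ... | no k≢l   = f (Equivalence.from (r k) (inj₁ (m , k≢l)))

  Falsified-premiseʳ : ∀ {A B C l} γ → IsResolvent A B l C → Falsified γ C →
    γ (decode (var l)) ≡ pol l → Falsified γ B
  Falsified-premiseʳ {l = l} γ (_ , _ , r) f e {k} m with k ≟ˡ comp l
  ... | yes refl = trans e (sym (neg-involutive _))
  ... | no k≢l   = f (Equivalence.from (r k) (inj₂ (m , k≢l)))

  _[_↦_] : Valuation → Var → Bool → Valuation
  (ξ [ v ↦ b ]) w with ≡-dec _≟ᵇ_ w v
  ... | yes _ = b
  ... | no  _ = ξ w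

  update-same : ∀ ξ v b → (ξ [ v ↦ b ]) v ≡ b
  update-same ξ v b with ≡-dec _≟ᵇ_ v v
  ... | yes _ = refl
  ... | no n  = ⊥-elim (n refl)

  update-other : ∀ ξ {v w} b → ¬ (w ≡ v) → (ξ [ v ↦ b ]) w ≡ ξ w
  update-other ξ {v} {w} b n with ≡-dec _≟ᵇ_ w v
  ... | yes e = ⊥-elim (n e)
  ... | no _  = refl

  _≈[_]_ : Valuation → List Var → Valuation → Set
  ξ ≈[ L ] ξ₀ = ∀ {v} → v ∈ L → ξ v ≡ ξ₀ v

  -- Together with `≈[ L ]` this determines both members of each pair in `L`.
  Fixed : List Var → (Valuation → Set) → Set
  Fixed L S = ∀ {v} → v ∈ L → Σ Bool λ b → ∀ α → S α → α v ≡ b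

  -- At the first query to one of the two variables of v, the adversary fixes the value of v;
  -- the queried variable itself stays free, so both premises must be large.
  size-≥ : ∀ d {C} (π : TreeDeriv formula C) S L ξ₀ → Hard P d S → Fixed L S →
    (∀ α ξ → S α → ξ ≈[ L ] ξ₀ → Falsified (blend α ξ) C) → 2 ^ d ≤ size π
  size-≥ zero (axiom _)     S L ξ₀ h fix fal = ≤-refl
  size-≥ zero (res _ _ _ _) S L ξ₀ h fix fal = s≤s z≤n
  size-≥ (suc d) (axiom m) S L ξ₀ (o , _) fix fal
    with x , m' , refl ← ∈-map⁻ clause m
    with t , p , q ← ∈-bind⁻ parts (∈-flatten⁻ (bind parts expand) m')
    with b , p' ← parts-∈ p
    -- The axiom excludes part of the points of value `b`, but the adversary still has a point of
    -- value `neg b`, which cannot falsify it.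
    with α , s , σ ← o (neg b)
    with u , r , τ ← σ part
    with y , q' , ω ← expand-sat {γ = blend α ξ₀} (λ _ → refl) τ =
    ⊥-elim (Conf-unsat (expand-Conf (opp P b≢neg-b part part p' r) q q')
      (Falsified-clause (fal α ξ₀ s (λ _ → refl))) ω)
  size-≥ (suc d) {C} (res {A} {B} l π ρ r) S L ξ₀ h@(o , q) fix fal = go (decode (var l)) refl
    where
    v≟ = ≡-dec _≟ᵇ_

    -- The pivot is constant on the remaining set, so one premise is falsified throughout and no
    -- budget is spent.
    forced : ∀ y → (∀ α ξ → S α → ξ ≈[ L ] ξ₀ → blend α ξ (decode (var l)) ≡ y) →
      2 ^ suc d ≤ suc (size π + size ρ)
    forced y e with pol l ≟ᵇ y
    ... | yes refl = ≤-trans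
      (size-≥ (suc d) ρ S L ξ₀ h fix (λ α ξ s g → Falsified-premiseʳ (blend α ξ) r (fal α ξ s g) (e α ξ s g)))
      (≤-trans (m≤n+m _ (size π)) (n≤1+n _))
    ... | no n = ≤-trans
      (size-≥ (suc d) π S L ξ₀ h fix
        (λ α ξ s g → Falsified-premiseˡ (blend α ξ) r (fal α ξ s g) (trans (e α ξ s g) (≢⇒≡neg n))))
      (≤-trans (m≤m+n _ (size ρ)) (n≤1+n _))

    -- Once `v` has the value `b`, setting its first member to `x b y` gives the pivot the value
    -- `y`; both `y` remain possible, so each premise has size at least `2 ^ d`.
    free : ∀ v → ¬ (v ∈ L) → (x : Bool → Bool → Bool) →
      (∀ b y α ξ → α v ≡ b → ξ v ≡ x b y → blend α ξ (decode (var l)) ≡ y) →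
      2 ^ suc d ≤ suc (size π + size ρ)
    free v v∉L x e with b , h' ← q v =
      ≤-trans (+-mono-≤ (size-≥ d π S' L' (ξ′ (neg (pol l))) h' fix' falˡ)
                (≤-trans (≤-reflexive (+-identityʳ _)) (size-≥ d ρ S' L' (ξ′ (pol l)) h' fix' falʳ)))
        (n≤1+n _)
      where
      S' = S ∩[ v ≔ b ]
      L' = v ∷ L
      ξ′ : Bool → Valuation
      ξ′ y = ξ₀ [ v ↦ x b y ]
      fix' : Fixed L' S'
      fix' (here refl) = b , λ α → proj₂
      fix' (there m)   = let c , f = fix m in c , λ α s → f α (proj₁ s)
      agree : ∀ {ξ y} → ξ ≈[ L' ] ξ′ y → ξ ≈[ L ] ξ₀
      agree g m = trans (g (there m)) (update-other ξ₀ _ λ { refl → v∉L m })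
      value : ∀ {α ξ y} → S' α → ξ ≈[ L' ] ξ′ y → blend α ξ (decode (var l)) ≡ y
      value {α} {ξ} {y} s g = e b y α ξ (proj₂ s) (trans (g (here refl)) (update-same ξ₀ v (x b y)))
      falˡ : ∀ α ξ → S' α → ξ ≈[ L' ] ξ′ (neg (pol l)) → Falsified (blend α ξ) A
      falˡ α ξ s g = Falsified-premiseˡ (blend α ξ) r (fal α ξ (proj₁ s) (agree g)) (value s g)
      falʳ : ∀ α ξ → S' α → ξ ≈[ L' ] ξ′ (pol l) → Falsified (blend α ξ) B
      falʳ α ξ s g = Falsified-premiseʳ (blend α ξ) r (fal α ξ (proj₁ s) (agree g)) (value s g)

    go : ∀ w → decode (var l) ≡ w → 2 ^ suc d ≤ suc (size π + size ρ)
    -- `blend` always gives `[]` the value false.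
    go [] eq = forced false λ α ξ s g → cong (blend α ξ) eq
    go (z ∷ v) eq with any? (v≟ v) L
    go (false ∷ v) eq | yes m = forced (ξ₀ v) λ α ξ s g → trans (cong (blend α ξ) eq) (g m)
    go (true ∷ v)  eq | yes m = forced (ξ₀ v ⊻ proj₁ (fix m)) λ α ξ s g →
      trans (cong (blend α ξ) eq) (cong₂ _⊻_ (g m) (proj₂ (fix m) α s))
    go (false ∷ v) eq | no n = free v n (λ b y → y) λ b y α ξ e e' → trans (cong (blend α ξ) eq) e'
    go (true ∷ v)  eq | no n = free v n (λ b y → y ⊻ b) λ b y α ξ e e' →
      trans (cong (blend α ξ) eq) (trans (cong₂ _⊻_ e' e) (⊻-self y b))

  formula-size : ∀ d → Hard P d All-valuations → (π : TreeRefutation formula) → 2 ^ d ≤ size π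
  formula-size d h π = size-≥ d π All-valuations [] (λ _ → false) h (λ ()) (λ _ _ _ _ ())

  formula-Bounded : ∀ {u} → (∀ b → Bounded u u (fam P part b)) →
    Bounded (suc u + u) (2 * u) (bind parts expand)
  formula-Bounded h = Bounded-bind (h false ⋎ h true) λ x p →
    Bounded-≤ p (*-monoʳ-≤ 2 p) (expand-Bounded x)

  numClauses-formula : ∀ {u} → (∀ b → Bounded u u (fam P part b)) →
    numClauses formula ≤ 2 ^ (suc u + u)
  numClauses-formula h =
    ≤-trans (≤-reflexive (length-map clause (flatten (bind parts expand)))) (length-flatten (formula-Bounded h))

  width-formula : ∀ {u} → (∀ b → Bounded u u (fam P part b)) →
    All (λ C → width C ≤ 2 * u) formula
  width-formula h = All.map⁺ (All.map (λ {x} p → ≤-trans (≤-reflexive (length-map negate x)) p)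
    (flatten-width (formula-Bounded h)))

-- Costs of the constructions

Fits : ℕ → Tree Term → Set
Fits n t = Bounded n n t

Fits-≤ : ∀ {m n t} → m ≤ n → Fits m t → Fits n t
Fits-≤ p = Bounded-≤ p p

record Cost (P : Prob Bool) (c₀ c₁ u₀ u₁ : ℕ) : Set where
  constructor cost
  field
    cert₀ : Fits c₀ (fam P cert false)
    cert₁ : Fits c₁ (fam P cert true)
    part₀ : Fits u₀ (fam P part false)
    part₁ : Fits u₁ (fam P part true)

Cost-≤ : ∀ {P c₀ c₁ u₀ u₁ c₀' c₁' u₀' u₁'} → c₀ ≤ c₀' → c₁ ≤ c₁' → u₀ ≤ u₀' → u₁ ≤ u₁' →
  Cost P c₀ c₁ u₀ u₁ → Cost P c₀' c₁' u₀' u₁'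
Cost-≤ p q r s (cost a b c d) = cost (Fits-≤ p a) (Fits-≤ q b) (Fits-≤ r c) (Fits-≤ s d)

single-Cost : Cost single 1 1 1 1
single-Cost = cost (one ≤-refl) (one ≤-refl) (one ≤-refl) (one ≤-refl)

flip-Cost : ∀ {P c₀ c₁ u₀ u₁} → Cost P c₀ c₁ u₀ u₁ → Cost (flip P) c₁ c₀ u₁ u₀
flip-Cost (cost a b c d) = cost b a d c

Fits-⋎ : ∀ {n s t} → Fits n s → Fits n t → Fits (suc n) (s ⋎ t)
Fits-⋎ a b = Bounded-≤ ≤-refl (n≤1+n _) (a ⋎ b)

and²-Cost : ∀ {P c₀ c₁ u₀ u₁} → Cost P c₀ c₁ u₀ u₁ →
  Cost (and² P) (suc c₀) (c₁ + c₁) (suc (u₁ + u₀)) (u₁ + u₁)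
and²-Cost {u₀ = u₀} {u₁} (cost a b c d) = cost
  (Fits-⋎ (Bounded-lift false a) (Bounded-lift true a))
  (Bounded-⊛ (Bounded-lift false b) (Bounded-lift true b))
  (Fits-⋎ (Fits-≤ (m≤n+m u₀ u₁) (Bounded-lift false c))
          (Bounded-⊛ (Bounded-lift false d) (Bounded-lift true c)))
  (Bounded-⊛ (Bounded-lift false d) (Bounded-lift true d))

conj : Prob Bool → ℕ → Prob Bool
conj P zero    = P
conj P (suc s) = and² (conj P s)

-- A certificate of false picks one of `2 ^ s` copies, which only adds depth `s`; a part of false
-- may also assert that all earlier copies are true, hence `2 ^ s * u₁`.
conj-Cost : ∀ {P c₀ c₁ u₀ u₁} s → Cost P c₀ c₁ u₀ u₁ →
  Cost (conj P s) (c₀ + s) (2 ^ s * c₁) (u₀ + 2 ^ s * u₁ + s) (2 ^ s * u₁)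
conj-Cost {c₀ = c₀} {c₁} {u₀} {u₁} zero k = Cost-≤
  (m≤m+n c₀ 0) (m≤m+n c₁ 0) (≤-trans (m≤m+n u₀ (u₁ + 0)) (m≤m+n _ 0)) (m≤m+n u₁ 0) k
conj-Cost {c₀ = c₀} {c₁} {u₀} {u₁} (suc s) k = Cost-≤
  (≤-reflexive (sym (+-suc c₀ s)))
  (≤-reflexive (double (2 ^ s) c₁))
  (≤-reflexive (rearrange (2 ^ s) u₀ u₁ s))
  (≤-reflexive (double (2 ^ s) u₁))
  (and²-Cost (conj-Cost s k))
  where
  double : ∀ n c → n * c + n * c ≡ 2 * n * c
  double = solve-∀
  rearrange : ∀ n u v s → suc (n * v + (u + n * v + s)) ≡ u + 2 * n * v + suc s
  rearrange = solve-∀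

conj-Hard : ∀ P s {d} → 0 < d → Hard P d All-valuations → Hard (conj P s) (2 ^ s * d) All-valuations
conj-Hard P zero {d} 0<d h = subst (λ d → Hard P d All-valuations) (sym (+-identityʳ d)) h
conj-Hard P (suc s) {d} 0<d h = subst (λ d → Hard (conj P (suc s)) d All-valuations)
  (double (2 ^ s) d) (and²-Hard (conj P s) (2 ^ s * d) (*-mono-≤ (m^n>0 2 s) 0<d) (conj-Hard P s 0<d h))
  where
  double : ∀ n d → n * d + n * d ≡ 2 * n * d
  double = solve-∀

power-Fits : ∀ {P k n} → (∀ b → Fits n (fam P k b)) → ∀ c o → Fits (c * n) (fam (power P c) k o)
power-Fits f zero    []      = one z≤n
power-Fits f (suc c) (b ∷ o) = Bounded-⊛ (Bounded-lift false (f b)) (Bounded-lift true (power-Fits f c o))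

-- `suc (a + a)` bounds the height of a sheet: the flag, `a` address bits and `a` literals. The
-- depth of the union over addresses is `c`, and `u` enters only the parts of false.
cheat-Cost : ∀ {c a u} (Q : Prob (Vec Bool c)) →
  (∀ o → Fits a (fam Q cert o)) → (∀ o → Fits u (fam Q part o)) →
  Cost (cheat Q) (c + (a + suc (a + a))) (c + suc (a + a)) (c + (u + suc (a + a))) (c + suc (a + a))
cheat-Cost {c} {a} {u} Q fc fp = cost (falses-Fits fc) trues-Fits (falses-Fits fp) trues-Fits
  where
  sheet-Fits : ∀ b o → Fits (suc (a + a)) (branches b (sheet Q o))
  sheet-Fits b o = branches-Bounded b (lookupCheck-height (cellVar o) (∅ ⋎ Bounded-lift false (fc o)))
  trues-Fits : Fits (c + suc (a + a)) (cheatFam Q cert true)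
  trues-Fits = Bounded-≤ ≤-refl (m≤n+m _ c) (Bounded-⋃ c (sheet-Fits true))
  falses-Fits : ∀ {k n} → (∀ o → Fits n (fam Q k o)) → Fits (c + (n + suc (a + a))) (cheatFam Q k false)
  falses-Fits f = Bounded-≤ ≤-refl (m≤n+m _ c)
    (Bounded-⋃ c λ o → Bounded-⊛ (Bounded-lift false (f o)) (sheet-Fits false o))

-- Iterated rounds

-- With n = 2 ^ s, one round multiplies the hardness by n² but the cost only by Õ(n):
-- the disjunction of n copies and then the conjunction of n copies multiply the hardness
-- by n each, while in between the cheat sheet brings the part families of the true
-- output down to the cost of the cert families.
round : ℕ → ℕ → Prob Bool → Prob Bool
round c s P = conj (cheat (power (flip (conj (flip P) s)) c)) s

-- The invariant is that certificates of false are `n` times cheaper than the rest. The disjunction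
-- and the cheat sheet bring all but the parts of false to about `c * (n * A)`; the conjunction
-- restores the gap.
round-Cost : ∀ {P} c s A → 1 ≤ c → s ≤ A → 1 ≤ A → let n = 2 ^ s ; A' = 16 * (c * (n * A)) in
  Cost P A (n * A) (n * A) (n * A) → Cost (round c s P) A' (n * A') (n * A') (n * A')
round-Cost {P} c s A 1≤c s≤A 1≤A k = Cost-≤ c₀≤ c₁≤ u₀≤ c₁≤
  (conj-Cost s (cheat-Cost (power R c) (power-Fits copyCerts c) (power-Fits copyParts c)))
  where
  n = 2 ^ s
  R = flip (conj (flip P) s)
  M = c * (n * A)
  a = n * A + s
  u = n * A + n * (n * A) + s
  1≤n : 1 ≤ n
  1≤n = m^n>0 2 s
  A≤nA : A ≤ n * A
  A≤nA = m≤n*m A n {{>-nonZero 1≤n}}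
  R-cost = flip-Cost (conj-Cost s (flip-Cost k))
  copyCerts : ∀ b → Fits a (fam R cert b)
  copyCerts false = Fits-≤ (m≤m+n (n * A) s) (Cost.cert₀ R-cost)
  copyCerts true  = Cost.cert₁ R-cost
  copyParts : ∀ b → Fits u (fam R part b)
  copyParts false = Fits-≤ (≤-trans (m≤n+m (n * (n * A)) (n * A)) (m≤m+n _ s)) (Cost.part₀ R-cost)
  copyParts true  = Cost.part₁ R-cost
  nA≤M : n * A ≤ M
  nA≤M = m≤n*m (n * A) c {{>-nonZero 1≤c}}
  s≤M : s ≤ M
  s≤M = ≤-trans s≤A (≤-trans A≤nA nA≤M)
  1≤M : 1 ≤ M
  1≤M = ≤-trans 1≤A (≤-trans A≤nA nA≤M)
  c≤M : c ≤ M
  c≤M = m≤m*n c (n * A) {{>-nonZero (≤-trans 1≤A A≤nA)}}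
  M≤nM : M ≤ n * M
  M≤nM = m≤n*m M n {{>-nonZero 1≤n}}
  cs≤M : c * s ≤ M
  cs≤M = *-monoʳ-≤ c (≤-trans s≤A A≤nA)
  ca≤ : c * a ≤ M + M
  ca≤ = ≤-trans (≤-reflexive (*-distribˡ-+ c (n * A) s)) (+-monoʳ-≤ M cs≤M)
  cu≤ : c * u ≤ M + n * M + M
  cu≤ = ≤-trans (≤-reflexive (expand′ c n A s)) (+-monoʳ-≤ (M + n * M) cs≤M)
    where
    expand′ : ∀ c n A s → c * (n * A + n * (n * A) + s) ≡ c * (n * A) + n * (c * (n * A)) + c * s
    expand′ = solve-∀
  sheet≤ : suc (c * a + c * a) ≤ M + ((M + M) + (M + M))
  sheet≤ = +-mono-≤ 1≤M (+-mono-≤ ca≤ ca≤)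
  true≤ : c + suc (c * a + c * a) ≤ 6 * M
  true≤ = ≤-trans (+-mono-≤ c≤M sheet≤) (≤-reflexive (total M))
    where
    total : ∀ M → M + (M + ((M + M) + (M + M))) ≡ 6 * M
    total = solve-∀
  c₀≤ : c + (c * a + suc (c * a + c * a)) + s ≤ 16 * M
  c₀≤ = ≤-trans (+-mono-≤ (+-mono-≤ c≤M (+-mono-≤ ca≤ sheet≤)) s≤M)
    (≤-trans (m≤m+n _ (7 * M)) (≤-reflexive (total M)))
    where
    total : ∀ M → M + ((M + M) + (M + ((M + M) + (M + M)))) + M + 7 * M ≡ 16 * M
    total = solve-∀
  c₁≤ : n * (c + suc (c * a + c * a)) ≤ n * (16 * M)
  c₁≤ = *-monoʳ-≤ n (≤-trans true≤ (*-monoˡ-≤ M (m≤m+n 6 10)))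
  -- The sum is `9 * M + 7 * (n * M)`, and `M ≤ n * M`: this is the source of 16.
  u₀≤ : c + (c * u + suc (c * a + c * a)) + n * (c + suc (c * a + c * a)) + s ≤ n * (16 * M)
  u₀≤ = ≤-trans
    (+-mono-≤ (+-mono-≤ (+-mono-≤ c≤M (+-mono-≤ cu≤ sheet≤)) (*-monoʳ-≤ n true≤)) s≤M)
    (≤-trans (≤-reflexive (total n M))
    (≤-trans (+-monoˡ-≤ (7 * (n * M)) (*-monoʳ-≤ 9 M≤nM)) (≤-reflexive (total′ n M))))
    where
    total : ∀ n M → M + ((M + n * M + M) + (M + ((M + M) + (M + M)))) + n * (6 * M) + M
      ≡ 9 * M + 7 * (n * M)
    total = solve-∀
    total′ : ∀ n M → 9 * (n * M) + 7 * (n * M) ≡ n * (16 * M)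
    total′ = solve-∀

-- The disjunction has hardness `2 ^ s * d`; with at least as many cells the cheat sheet preserves
-- it.
round-Hard : ∀ P c s {d} → 0 < d → 2 ^ s * d ≤ 2 ^ c → Hard P d All-valuations →
  Hard (round c s P) (2 ^ s * (2 ^ s * d)) All-valuations
round-Hard P c s {d} 0<d d≤ h = conj-Hard _ s 0<nd
  (cheat-Hard (power R c) _ d≤ (power-Hard R c _
    (flip-Hard (conj (flip P) s) _ (conj-Hard (flip P) s 0<d (flip-Hard P _ h)))))
  where
  R = flip (conj (flip P) s)
  0<nd : 0 < 2 ^ s * d
  0<nd = *-mono-≤ (m^n>0 2 s) 0<d

level : ℕ → ℕ → ℕ → Prob Bool
level c s zero    = conj single s
level c s (suc k) = round c s (level c s k)

-- Starting from `2 + s`, the bound `n * A` also covers the parts of false of the initial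
-- conjunction, of cost `1 + n + s`.
levelCost : ℕ → ℕ → ℕ → ℕ
levelCost c s zero    = 2 + s
levelCost c s (suc k) = 16 * (c * (2 ^ s * levelCost c s k))

levelCost-≥ : ∀ c s k → 1 ≤ c → 2 + s ≤ levelCost c s k
levelCost-≥ c s zero    1≤c = ≤-refl
levelCost-≥ c s (suc k) 1≤c = ≤-trans (levelCost-≥ c s k 1≤c)
  (≤-trans (m≤n*m _ (2 ^ s) {{>-nonZero (m^n>0 2 s)}})
  (≤-trans (m≤n*m _ c {{>-nonZero 1≤c}}) (m≤n*m _ 16)))

level-Cost : ∀ c s k → 1 ≤ c → let n = 2 ^ s ; A = levelCost c s k in
  Cost (level c s k) A (n * A) (n * A) (n * A)
level-Cost c s zero 1≤c = Cost-≤ (n≤1+n _) n≤ u≤ n≤ (conj-Cost s single-Cost)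
  where
  n = 2 ^ s
  n≤ : n * 1 ≤ n * (2 + s)
  n≤ = *-monoʳ-≤ n (s≤s z≤n)
  u≤ : 1 + n * 1 + s ≤ n * (2 + s)
  u≤ = ≤-trans (≤-reflexive (total s n))
    (≤-trans (+-monoˡ-≤ (n * 1) (m≤n*m (1 + s) n {{>-nonZero (m^n>0 2 s)}})) (≤-reflexive (total′ s n)))
    where
    total : ∀ s n → 1 + n * 1 + s ≡ 1 + s + n * 1
    total = solve-∀
    total′ : ∀ s n → n * (1 + s) + n * 1 ≡ n * (2 + s)
    total′ = solve-∀
level-Cost c s (suc k) 1≤c = round-Cost c s (levelCost c s k) 1≤c
  (≤-trans (m≤n+m s 2) (levelCost-≥ c s k 1≤c)) (≤-trans (s≤s z≤n) (levelCost-≥ c s k 1≤c))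
  (level-Cost c s k 1≤c)

-- Each round adds `2 * s` to the exponent. The hypothesis is what the cheat sheet of the last round
-- demands.
level-Hard : ∀ c s k → s * (2 * k) ≤ c → Hard (level c s k) (2 ^ (s * (1 + 2 * k))) All-valuations
level-Hard c s zero _ = subst (λ d → Hard (conj single s) d All-valuations)
  (trans (*-identityʳ (2 ^ s)) (cong (2 ^_) (sym (*-identityʳ s)))) (conj-Hard single s ≤-refl single-Hard)
level-Hard c s (suc k) sk≤ = subst (λ d → Hard (level c s (suc k)) d All-valuations)
  (trans (cong (2 ^ s *_) n*D) (trans (sym (^-distribˡ-+-* 2 s _)) (cong (2 ^_) (next s k))))
  (round-Hard (level c s k) c s (m^n>0 2 (s * (1 + 2 * k)))
    (≤-trans (≤-reflexive n*D) (^-monoʳ-≤ 2 (≤-trans (≤-reflexive (prev s k)) sk≤)))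
    (level-Hard c s k (≤-trans (*-monoʳ-≤ s (*-monoʳ-≤ 2 (n≤1+n k))) sk≤)))
  where
  n*D : 2 ^ s * 2 ^ (s * (1 + 2 * k)) ≡ 2 ^ (s + s * (1 + 2 * k))
  n*D = sym (^-distribˡ-+-* 2 s _)
  prev : ∀ s k → s + s * (1 + 2 * k) ≡ s * (2 * suc k)
  prev = solve-∀
  next : ∀ s k → s + (s + s * (1 + 2 * k)) ≡ s * (1 + 2 * suc k)
  next = solve-∀

-- Separates the power of `n` from the polylogarithmic overhead; each round contributes `n` and
-- `16 * e * ℓ`.
levelCost-≤ : ∀ c s k e ℓ → c ≤ e * ℓ → 2 + s ≤ 3 * ℓ →
  levelCost c s k ≤ (2 ^ s) ^ k * ((16 * e) ^ k * 3 * ℓ ^ suc k)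
levelCost-≤ c s zero e ℓ c≤ s≤ = ≤-trans s≤ (≤-reflexive (total ℓ))
  where
  total : ∀ ℓ → 3 * ℓ ≡ 1 * (1 * 3 * (ℓ * 1))
  total = solve-∀
levelCost-≤ c s (suc k) e ℓ c≤ s≤ = ≤-trans
  (*-monoʳ-≤ 16 (*-mono-≤ c≤ (*-monoʳ-≤ (2 ^ s) (levelCost-≤ c s k e ℓ c≤ s≤))))
  (≤-reflexive (total (2 ^ s) ((2 ^ s) ^ k) e ((16 * e) ^ k) ℓ (ℓ ^ suc k)))
  where
  total : ∀ n nᵏ e eᵏ ℓ ℓᵏ → 16 * (e * ℓ * (n * (nᵏ * (eᵏ * 3 * ℓᵏ))))
    ≡ n * nᵏ * (16 * e * eᵏ * 3 * (ℓ * ℓᵏ))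
  total = solve-∀

-- Choice of parameters

scale : ∀ b → 1 < b → ∀ m → Σ ℕ λ s → b ^ s ≤ suc m × suc m < b ^ suc s
scale b 1<b zero = 0 , ≤-refl , subst (1 <_) (sym (*-identityʳ b)) 1<b
scale b 1<b (suc m) with s , l , u ← scale b 1<b m with suc (suc m) <? b ^ suc s
... | yes p = s , ≤-trans l (n≤1+n _) , p
... | no ¬p = suc s , ≮⇒≥ ¬p , ≤-<-trans u (^-monoʳ-< b 1<b (n<1+n (suc s)))

-- In terms of exponents: `x / q` is at most 2 - 1 / (q + 1), the exponent reached after `q` rounds.
x-bound : ∀ q x → x < 2 * q → suc q * x ≤ (1 + 2 * q) * q
x-bound q x x<2q = +-cancelʳ-≤ (suc q) _ _ (begin
  suc q * x + suc q             ≡⟨ total q x ⟩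
  suc q * suc x                 ≤⟨ *-monoʳ-≤ (suc q) x<2q ⟩
  suc q * (2 * q)               ≡⟨ total′ q ⟩
  (1 + 2 * q) * q + q           ≤⟨ +-monoʳ-≤ _ (n≤1+n q) ⟩
  (1 + 2 * q) * q + suc q       ∎)
  where
  open ≤-Reasoning
  total : ∀ q x → suc q * x + suc q ≡ suc q * suc x
  total = solve-∀
  total′ : ∀ q → suc q * (2 * q) ≡ (1 + 2 * q) * q + q
  total′ = solve-∀

theorem3p15 : (p q : ℕ) → 0 < p → p < 2 * q →
    Σ (ℕ → CNF) λ G → Σ ℕ λ K → Σ ℕ λ m₀ → (m : ℕ) → m₀ ≤ m →
    Hitting (G m) × Unsatisfiable (G m)
    × numClauses (G m) ≤ 2 ^ (K * m * ⌈log₂ m ⌉ ^ K)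
    × All (λ C → width C ≤ K * m * ⌈log₂ m ⌉ ^ K) (G m)
    × ((π : TreeRefutation (G m)) →
    m ^ (2 * q ∸ p) ≤ (K * ⌊log₂ size π ⌋ * ⌈log₂ m ⌉ ^ K) ^ q)
theorem3p15 p q 0<p p<2q = G , K , b , bounds
  where
  -- With this base, `b ^ s` is `n ^ suc q` for `n = 2 ^ s`, the main factor of the cost.
  b = 2 ^ suc q

  1<b : 1 < b
  1<b = *-monoʳ-≤ 2 (m^n>0 2 q)

  -- The address length `s * e` is at least the `s * (2 * q)` that hardness demands, yet logarithmic
  -- in `m`.
  e = 2 + 2 * q

  G : ℕ → CNF
  -- A default value: the index 0 lies below the threshold `b`.
  G zero    = []
  G (suc m) = let s = proj₁ (scale b 1<b m) in formula (level (s * e) s q)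

  B = (16 * e) ^ q * 3

  -- The summands serve the constant in the cost, the exponent of the logarithm, and the rounding of
  -- `m` to a power of `b`.
  K = 3 * B + suc q + 2 ^ (1 + 2 * q)

  3B≤K : 3 * B ≤ K
  3B≤K = ≤-trans (m≤m+n (3 * B) (suc q)) (m≤m+n _ (2 ^ (1 + 2 * q)))

  q<K : suc q ≤ K
  q<K = ≤-trans (m≤n+m (suc q) (3 * B)) (m≤m+n _ (2 ^ (1 + 2 * q)))

  2≤K : 2 ^ (1 + 2 * q) ≤ K
  2≤K = m≤n+m _ (3 * B + suc q)

  open ≤-Reasoning

  bounds : ∀ m → b ≤ m → Hitting (G m) × Unsatisfiable (G m)
    × numClauses (G m) ≤ 2 ^ (K * m * ⌈log₂ m ⌉ ^ K)
    × All (λ C → width C ≤ K * m * ⌈log₂ m ⌉ ^ K) (G m)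
    × ((π : TreeRefutation (G m)) →
       m ^ (2 * q ∸ p) ≤ (K * ⌊log₂ size π ⌋ * ⌈log₂ m ⌉ ^ K) ^ q)
  bounds zero b≤0 = ⊥-elim (<⇒≱ (≤-trans (s≤s z≤n) 1<b) b≤0)
  bounds (suc m′) b≤m =
    formula-Hitting P , formula-Unsat P ,
    ≤-trans (numClauses-formula P partition) (^-monoʳ-≤ 2 (≤-trans count≤ cost≤)) ,
    All.map (λ w≤ → ≤-trans w≤ (≤-trans (*-monoˡ-≤ u (n≤1+n 2)) cost≤)) (width-formula P partition) ,
    hard
    where
    m = suc m′
    s = proj₁ (scale b 1<b m′)
    c = s * e
    ℓ = ⌈log₂ m ⌉
    P = level c s q
    n = 2 ^ s
    A = levelCost c s q
    u = n * A


    bˢ≤m : b ^ s ≤ m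
    bˢ≤m = proj₁ (proj₂ (scale b 1<b m′))

    m<bˢ⁺¹ : m < b ^ suc s
    m<bˢ⁺¹ = proj₂ (proj₂ (scale b 1<b m′))

    1≤s : 1 ≤ s
    1≤s with s in eq
    ... | zero  = ⊥-elim (<⇒≱ m<bˢ⁺¹ (subst (λ s → b ^ suc s ≤ m) (sym eq)
      (≤-trans (≤-reflexive (*-identityʳ b)) b≤m)))
    ... | suc _ = s≤s z≤n

    s≤ℓ : s ≤ ℓ
    s≤ℓ = ≤-trans (≤-reflexive (sym (⌈log₂2^n⌉≡n s)))
      (⌈log₂⌉-mono-≤ (≤-trans (^-monoˡ-≤ s 1<b) bˢ≤m))

    1≤ℓ : 1 ≤ ℓ
    1≤ℓ = ≤-trans 1≤s s≤ℓ

    1≤c : 1 ≤ c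
    1≤c = *-mono-≤ {1} {s} {1} {e} 1≤s (s≤s z≤n)

    ℓ^-mono : ∀ {i j} → i ≤ j → ℓ ^ i ≤ ℓ ^ j
    ℓ^-mono = ^-monoʳ-≤ ℓ {{>-nonZero 1≤ℓ}}

    A≤ : A ≤ n ^ q * (B * ℓ ^ suc q)
    A≤ = levelCost-≤ c s q e ℓ (≤-trans (*-monoˡ-≤ e s≤ℓ) (≤-reflexive (*-comm ℓ e)))
      (≤-trans (+-mono-≤ (*-monoʳ-≤ 2 1≤ℓ) s≤ℓ) (≤-reflexive (+-comm (2 * ℓ) ℓ)))

    nᵠ⁺¹≤m : n ^ suc q ≤ m
    nᵠ⁺¹≤m = ≤-trans (≤-reflexive (trans (^-*-assoc 2 s (suc q))
      (trans (cong (2 ^_) (*-comm s (suc q))) (sym (^-*-assoc 2 (suc q) s))))) bˢ≤m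

    -- `3 * u` dominates both the exponent `suc u + u` of the clause count and the width `2 * u`.
    cost≤ : 3 * u ≤ K * m * ℓ ^ K
    cost≤ = begin
      3 * (n * A)                              ≤⟨ *-monoʳ-≤ 3 (*-monoʳ-≤ n A≤) ⟩
      3 * (n * (n ^ q * (B * ℓ ^ suc q)))      ≡⟨ rearrange n (n ^ q) B (ℓ ^ suc q) ⟩
      3 * B * (n * n ^ q) * ℓ ^ suc q          ≤⟨ *-mono-≤ (*-mono-≤ 3B≤K nᵠ⁺¹≤m) (ℓ^-mono q<K) ⟩
      K * m * ℓ ^ K                            ∎
      where
      rearrange : ∀ n x b y → 3 * (n * (x * (b * y))) ≡ 3 * b * (n * x) * y
      rearrange = solve-∀

    count≤ : suc u + u ≤ 3 * u
    count≤ = ≤-trans (≤-reflexive (sym (+-suc u u))) (+-monoʳ-≤ u (+-mono-≤ 1≤u (m≤m+n u 0)))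
      where
      1≤u : 1 ≤ u
      1≤u = *-mono-≤ (m^n>0 2 s) (≤-trans (s≤s z≤n) (levelCost-≥ c s q 1≤c))

    partition : ∀ o → Bounded u u (fam P part o)
    partition false = Cost.part₀ (level-Cost c s q 1≤c)
    partition true  = Cost.part₁ (level-Cost c s q 1≤c)

    D = 2 ^ (s * (1 + 2 * q))

    D≤log : (π : TreeRefutation (formula P)) → D ≤ ⌊log₂ size π ⌋
    D≤log π = ≤-trans (≤-reflexive (sym (⌊log₂[2^n]⌋≡n D)))
      (⌊log₂⌋-mono-≤ (formula-size P D (level-Hard c s q (*-monoʳ-≤ s (m≤n+m (2 * q) 2))) π))

    hard : (π : TreeRefutation (formula P)) →
      m ^ (2 * q ∸ p) ≤ (K * ⌊log₂ size π ⌋ * ℓ ^ K) ^ q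
    hard π = begin
      m ^ x                                    ≤⟨ ^-monoˡ-≤ x (<⇒≤ m<bˢ⁺¹) ⟩
      (b ^ suc s) ^ x                          ≡⟨ trans (cong (_^ x) (^-*-assoc 2 (suc q) (suc s))) (^-*-assoc 2 (suc q * suc s) x) ⟩
      2 ^ (suc q * suc s * x)                  ≤⟨ ^-monoʳ-≤ 2 exponent ⟩
      2 ^ (suc s * (1 + 2 * q) * q)            ≡⟨ sym (^-*-assoc 2 (suc s * (1 + 2 * q)) q) ⟩
      (2 ^ (suc s * (1 + 2 * q))) ^ q          ≡⟨ cong (_^ q) (^-distribˡ-+-* 2 (1 + 2 * q) (s * (1 + 2 * q))) ⟩
      -- The factor beside `D` is the price of rounding `m` up to `b ^ suc s`; `K` absorbs it.
      (2 ^ (1 + 2 * q) * D) ^ q                ≤⟨ ^-monoˡ-≤ q (*-mono-≤ 2≤K (D≤log π)) ⟩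
      (K * ⌊log₂ size π ⌋) ^ q                 ≤⟨ ^-monoˡ-≤ q (m≤m*n _ (ℓ ^ K) {{>-nonZero (ℓ^-mono {0} {K} z≤n)}}) ⟩
      (K * ⌊log₂ size π ⌋ * ℓ ^ K) ^ q         ∎
      where
      x = 2 * q ∸ p
      exponent : suc q * suc s * x ≤ suc s * (1 + 2 * q) * q
      exponent = begin
        suc q * suc s * x            ≡⟨ rearrange q s x ⟩
        suc s * (suc q * x)          ≤⟨ *-monoʳ-≤ (suc s) (x-bound q x (∸-monoʳ-< 0<p (<⇒≤ p<2q))) ⟩
        suc s * ((1 + 2 * q) * q)    ≡⟨ sym (*-assoc (suc s) (1 + 2 * q) q) ⟩
        suc s * (1 + 2 * q) * q      ∎
        where
        rearrange : ∀ q s x → suc q * suc s * x ≡ suc s * (suc q * x)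
        rearrange = solve-∀
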